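{- Let $G$ be a projection game, let $0<\rho\le 1$ and suppose $\mathrm{val}(G)\le\rho$. Then for every integer $k\ge 1$, $$\mathrm{val}(G^{\otimes k})\le\left(\frac{2\sqrt{\rho}}{1+\rho}\right)^{k/2}.$$
   Context: Games. A (one-round two-player) game $G$ is given by finite vertex sets $U,V$, a finite alphabet $\Sigma$, and a finite nonnegatively weighted bipartite multigraph between $U$ and $V$ (parallel edges allowed) whose edges carry constraints $\pi\subseteq\Sigma\times\Sigma$; choosing an edge with probability proportional to its weight gives a distribution on triples $(u,v,\pi)$. $G$ is a projection game if for every constraint $\pi$ occurring in it and every $\beta\in\Sigma$ there is at most one $\alpha\in\Sigma$ with $(\alpha,\beta)\in\pi$. The value is $\mathrm{val}(G)=\max_{f,g}\Pr_{(u,v,\pi)}[(f(u),g(v))\in\pi]$ over all $f:U\to\Sigma$, $g:V\to\Sigma$. Products. For games $G$ (on $U,V,\Sigma$) and $H$ (on $U',V',\Sigma'$), $G\otimes H$ is the game on $U\times U'$, $V\times V'$ with alphabet $\Sigma\times\Sigma'$: $(u,v,\pi)$ from $G$ and $(u',v',\pi')$ from $H$ are drawn independently, the questions are $(u,u')$ and $(v,v')$, and answers $(\alpha,\alpha'),(\beta,\beta')$ are accepted iff $(\alpha,\beta)\in\pi$ and $(\alpha',\beta')\in\pi'$. $G^{\otimes k}=G\otimes\cdots\otimes G$ ($k$ times). -}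

module Defs where

open import Algebra.Bundles using (CommutativeRing; Semiring)
import Algebra.Definitions.RawSemiring as RawSemiringDefinitions
open import Data.Bool.Base using (Bool; T; _∧_; if_then_else_)
open import Data.Fin.Base using (Fin; finToFun)
open import Data.Fin.Properties using (*↔×)
open import Data.List.Base using (List; []; _∷_; _++_; map; foldr; cartesianProductWith)
open import Data.List.Relation.Unary.All using (All)
open import Data.Nat.Base as ℕ using (ℕ; zero; suc; NonZero)
open import Data.Product.Base using (_×_; _,_; proj₁; proj₂; ∃)
open import Data.Product.Function.NonDependent.Propositional using (_×-↔_)
open import Data.Vec.Functional as Vector using ()
open import Function.Base using (_∘_)
open import Function.Bundles using (_↔_; Inverse)
open import Function.Construct.Composition using (_↔-∘_)
open import Function.Construct.Symmetry using (↔-sym)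
open import Level using (Level) renaming (suc to lsuc; _⊔_ to _⊔ˡ_; zero to 0ℓ)
open import Relation.Binary.Core using (Rel)
open import Relation.Binary.Definitions using (Cotransitive)
open import Relation.Binary.PropositionalEquality.Core using (_≡_)
import Relation.Binary.Reasoning.Setoid as SetoidReasoning
open import Relation.Binary.Structures using (IsStrictPartialOrder)
open import Relation.Nullary.Negation.Core using (¬_)

-- The real numbers, axiomatised as a Cauchy complete Archimedean ordered field.
-- Classically these axioms determine ℝ up to unique isomorphism.  They are
-- phrased constructively (no decidability of the order is assumed, the primitive
-- relation is _<_, and x ≤ y means ¬ (y < x)), so that the usual constructions
-- of ℝ from Cauchy sequences of rationals satisfy them as well.
record RealNumbers (c ℓ₁ ℓ₂ : Level) : Set (lsuc (c ⊔ˡ ℓ₁ ⊔ˡ ℓ₂)) where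
  infix  4 _<_ _≤_
  infixl 6 _⊔_
  infixl 7 _/_[_]
  infix  8 _^[_/2]
  infix  9 √_

  field
    commutativeRing : CommutativeRing c ℓ₁

  open CommutativeRing commutativeRing public hiding (zero)
  open RawSemiringDefinitions (Semiring.rawSemiring semiring) public using (_^_)
  open RawSemiringDefinitions (Semiring.rawSemiring semiring) using () renaming (_×_ to infixr 8 _·_)

  field
    _<_                  : Rel Carrier ℓ₂
    <-isStrictPartialOrder : IsStrictPartialOrder _≈_ _<_
    <-cotrans            : Cotransitive _<_
    ≮-antisym            : ∀ {x y} → ¬ (x < y) → ¬ (y < x) → x ≈ y
    0<1                  : 0# < 1#
    +-monoˡ-<            : ∀ z {x y} → x < y → x + z < y + z
    *-pos                : ∀ {x y} → 0# < x → 0# < y → 0# < x * y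

  _≤_ : Rel Carrier ℓ₂
  x ≤ y = ¬ (y < x)

  field
    recip         : ∀ x → 0# < x → Carrier
    *-recip       : ∀ x (0<x : 0# < x) → x * recip x 0<x ≈ 1#

    _⊔_           : Carrier → Carrier → Carrier
    x≤x⊔y         : ∀ x y → x ≤ x ⊔ y
    y≤x⊔y         : ∀ x y → y ≤ x ⊔ y
    ⊔-lub         : ∀ {x y z} → x ≤ z → y ≤ z → x ⊔ y ≤ z

    archimedean   : ∀ x → ∃ λ n → x < n · 1#
    complete      : ∀ (a : ℕ → Carrier) →
                    (∀ ε → 0# < ε → ∃ λ N → ∀ m n → N ℕ.≤ m → N ℕ.≤ n → a m < a n + ε) →
                    ∃ λ l → ∀ ε → 0# < ε → ∃ λ N → ∀ n → N ℕ.≤ n → a n < l + ε × l < a n + ε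

    -- Unspecified on negative arguments; on x ≥ 0 the two laws determine √ x.
    √_            : Carrier → Carrier
    √-nonneg      : ∀ {x} → 0# ≤ x → 0# ≤ √ x
    √-square      : ∀ {x} → 0# ≤ x → √ x * √ x ≈ x

  module <-SPO = IsStrictPartialOrder <-isStrictPartialOrder

  _/_[_] : (x y : Carrier) → 0# < y → Carrier
  x / y [ 0<y ] = x * recip y 0<y

  2# : Carrier
  2# = 1# + 1#

  -- x ^[ k /2] is the power x^{k/2} of x ≥ 0.
  _^[_/2] : Carrier → ℕ → Carrier
  x ^[ k /2] = (√ x) ^ k

  sum : List Carrier → Carrier
  sum = foldr _+_ 0#

  -- The maximum of 0 and finitely many numbers.
  max₀ : ∀ {n} → (Fin n → Carrier) → Carrier
  max₀ = Vector.foldr _⊔_ 0#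

  0<1+ : ∀ {x} → 0# < x → 0# < 1# + x
  0<1+ {x} 0<x = <-SPO.trans 0<x
    (proj₁ <-SPO.<-resp-≈ refl (proj₂ <-SPO.<-resp-≈ (+-identityˡ x) (+-monoˡ-< x 0<1)))

  *-nonneg : ∀ {x y} → 0# ≤ x → 0# ≤ y → 0# ≤ x * y
  *-nonneg {x} {y} 0≤x 0≤y xy<0 = x≯0 λ 0<x → y≯0 λ 0<y →
    <-SPO.asym xy<0 (*-pos 0<x 0<y)
    where
    xy≉0 : ¬ (x * y ≈ 0#)
    xy≉0 xy≈0 = <-SPO.irrefl xy≈0 xy<0

    x≯0 : ¬ ¬ (0# < x)
    x≯0 ¬0<x = xy≉0 (trans (*-congʳ (≮-antisym 0≤x ¬0<x)) (zeroˡ y))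

    y≯0 : ¬ ¬ (0# < y)
    y≯0 ¬0<y = xy≉0 (trans (*-congˡ (≮-antisym 0≤y ¬0<y)) (zeroʳ x))

record FinSet : Set₁ where
  field
    Element : Set
    size    : ℕ
    enum    : Element ↔ Fin size

  index : Element → Fin size
  index = Inverse.to enum

  element : Fin size → Element
  element = Inverse.from enum

open FinSet using (Element; size; index; element)

_×ᶠ_ : FinSet → FinSet → FinSet
A ×ᶠ B = record
  { Element = Element A × Element B
  ; size    = size A ℕ.* size B
  ; enum    = ↔-sym *↔× ↔-∘ (FinSet.enum A ×-↔ FinSet.enum B)
  }

-- The functions A → B, enumerated (up to pointwise equality) by Fin (|B| ^ |A|).
function : ∀ (A B : FinSet) → Fin (size B ℕ.^ size A) → Element A → Element B
function A B i = element B ∘ finToFun i ∘ index A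

module Games {c ℓ₁ ℓ₂} (ℝ : RealNumbers c ℓ₁ ℓ₂) where
  open RealNumbers ℝ

  infixr 7 _⊗_
  infix  8 _^⊗_

  record Edge (U V Σ : FinSet) : Set (c ⊔ˡ ℓ₂) where
    field
      source        : Element U
      target        : Element V
      accepts       : Element Σ → Element Σ → Bool
      weight        : Carrier
      weight-nonneg : 0# ≤ weight

  open Edge

  totalWeight : ∀ {U V Σ} → List (Edge U V Σ) → Carrier
  totalWeight = sum ∘ map weight

  -- The total weight has to be positive for the distribution on edges to exist.
  record Game : Set (lsuc 0ℓ ⊔ˡ c ⊔ˡ ℓ₂) where
    field
      U V Σ     : FinSet
      edges     : List (Edge U V Σ)
      total-pos : 0# < totalWeight edges

  open Game

  IsProjection : Game → Set (c ⊔ˡ ℓ₂)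
  IsProjection G = All
    (λ e → ∀ (β α α′ : Element (Σ G)) → T (accepts e α β) → T (accepts e α′ β) → α ≡ α′)
    (edges G)

  acceptedWeight : ∀ {U V Σ} → (Element U → Element Σ) → (Element V → Element Σ) →
                   Edge U V Σ → Carrier
  acceptedWeight f g e = if accepts e (f (source e)) (g (target e)) then weight e else 0#

  winProb : (G : Game) → (Element (U G) → Element (Σ G)) →
            (Element (V G) → Element (Σ G)) → Carrier
  winProb G f g =
    sum (map (acceptedWeight f g) (edges G)) / totalWeight (edges G) [ total-pos G ]

  -- As probabilities are nonnegative, including 0 in the maximum only matters when
  -- there are no strategies at all (empty alphabet), where it makes the value 0.
  val : Game → Carrier
  val G = max₀ λ i → max₀ λ j → winProb G (function (U G) (Σ G) i) (function (V G) (Σ G) j)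

  _⊗ᵉ_ : ∀ {U V Σ U′ V′ Σ′} → Edge U V Σ → Edge U′ V′ Σ′ →
         Edge (U ×ᶠ U′) (V ×ᶠ V′) (Σ ×ᶠ Σ′)
  e ⊗ᵉ e′ = record
    { source        = source e , source e′
    ; target        = target e , target e′
    ; accepts       = λ { (α , α′) (β , β′) → accepts e α β ∧ accepts e′ α′ β′ }
    ; weight        = weight e * weight e′
    ; weight-nonneg = *-nonneg (weight-nonneg e) (weight-nonneg e′)
    }

  totalWeight-++ : ∀ {U V Σ} (es es′ : List (Edge U V Σ)) →
                   totalWeight (es ++ es′) ≈ totalWeight es + totalWeight es′
  totalWeight-++ []       es′ = sym (+-identityˡ _)
  totalWeight-++ (e ∷ es) es′ =
    trans (+-congˡ (totalWeight-++ es es′)) (sym (+-assoc _ _ _))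

  totalWeight-map : ∀ {U V Σ U′ V′ Σ′} (e : Edge U V Σ) (es′ : List (Edge U′ V′ Σ′)) →
                    totalWeight (map (e ⊗ᵉ_) es′) ≈ weight e * totalWeight es′
  totalWeight-map e []         = sym (zeroʳ _)
  totalWeight-map e (e′ ∷ es′) =
    trans (+-congˡ (totalWeight-map e es′)) (sym (distribˡ _ _ _))

  totalWeight-⊗ : ∀ {U V Σ U′ V′ Σ′} (es : List (Edge U V Σ)) (es′ : List (Edge U′ V′ Σ′)) →
                  totalWeight (cartesianProductWith _⊗ᵉ_ es es′)
                    ≈ totalWeight es * totalWeight es′
  totalWeight-⊗ []       es′ = sym (zeroˡ _)
  totalWeight-⊗ (e ∷ es) es′ = begin
    totalWeight (map (e ⊗ᵉ_) es′ ++ cartesianProductWith _⊗ᵉ_ es es′)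
      ≈⟨ totalWeight-++ (map (e ⊗ᵉ_) es′) _ ⟩
    totalWeight (map (e ⊗ᵉ_) es′) + totalWeight (cartesianProductWith _⊗ᵉ_ es es′)
      ≈⟨ +-cong (totalWeight-map e es′) (totalWeight-⊗ es es′) ⟩
    weight e * totalWeight es′ + totalWeight es * totalWeight es′
      ≈⟨ sym (distribʳ _ _ _) ⟩
    (weight e + totalWeight es) * totalWeight es′ ∎
    where open SetoidReasoning setoid

  _⊗_ : Game → Game → Game
  G ⊗ H = record
    { U         = U G ×ᶠ U H
    ; V         = V G ×ᶠ V H
    ; Σ         = Σ G ×ᶠ Σ H
    ; edges     = cartesianProductWith _⊗ᵉ_ (edges G) (edges H)
    ; total-pos = proj₁ <-SPO.<-resp-≈ (sym (totalWeight-⊗ (edges G) (edges H)))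
                    (*-pos (total-pos G) (total-pos H))
    }

  _^⊗_ : Game → (k : ℕ) → .{{NonZero k}} → Game
  G ^⊗ suc zero      = G
  G ^⊗ suc k@(suc _) = G ⊗ (G ^⊗ k)

{-# OPTIONS --safe #-}

-- For a strategy g of the second player let the collision weight of g be
-- ∑ᵤ ∑_α ι(u) (∑ of the weights of the edges at u whose constraint accepts α with
-- g's answer)², where ι(u) is the inverse of the weight of u: up to the total weight,
-- the probability that two independent edges at a random u force the same answer α.
-- By Cauchy–Schwarz it bounds the square of the winning probability, and for a
-- projection game it is in turn at most the value.  So it suffices that tensoring
-- with G multiplies the maximal collision weight by at most 2√ρ/(1+ρ) (per total weight).
--
-- Fixing the questions and answers ω of the other factor turns a strategy for G ⊗ H
-- into an assignment of nonnegative vectors h_ω(v,·) to the vertices v of G, with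
-- ∑_ω q_ω (∑_β h_ω(v,β))² bounded by the collision weight K of H.  By convexity one may
-- assume that h_ω(v,·) is a multiple m_ω(v) of a point mass at some b_ω(v).
-- Correlated sampling of v ↦ b_ω(v) with intensities q_ω m_ω(v)² then yields strategies
-- of G winning the pair (v,v′) with probability at least x/(2K−x), where
-- x = ∑_ω q_ω min(m_ω(v)², m_ω(v′)²) over the ω on which v and v′ agree.  Since no
-- strategy of G exceeds ρ, this bounds the average of x, hence, by
-- 2√ρ m m′ ≤ min(m²,m′²) + ρ max(m²,m′²), the collision weight of G ⊗ H.
--
-- All inequalities are negations, so the argument may reason classically.

module Submission where

open import Defs
open import Algebra.Bundles using (CommutativeRing)
import Algebra.Properties.Ring as RingProperties
import Algebra.Properties.Semiring.Mult.TCOptimised as Multiples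
import Algebra.Solver.Ring
open import Algebra.Solver.Ring.AlmostCommutativeRing
  using (fromCommutativeRing; _-Raw-AlmostCommutative⟶_; Induced-equivalence)
open import Data.Bool.Base as Bool using (Bool; true; false; if_then_else_; _∧_; _∨_)
open import Data.Bool.Properties using () renaming (_≟_ to _≟ᵇ_)
open import Data.Empty using (⊥-elim)
open import Data.Fin.Base using (Fin; zero; suc; funToFin)
import Data.Fin.Properties as Fin
open import Data.Integer.Base as ℤ using (ℤ; +_; -[1+_])
import Data.Integer.Properties as ℤ
open import Data.List.Base
  using (List; []; _∷_; _++_; map; filter; length; tabulate; cartesianProduct; cartesianProductWith)
import Data.List.Membership.DecPropositional as DecMembership
open import Data.List.Membership.Propositional using (_∈_; lose)
open import Data.List.Membership.Propositional.Properties using (∈-tabulate⁺; ∈-cartesianProduct⁻)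
open import Data.List.Properties using (filter-notAll)
open import Data.List.Relation.Binary.Permutation.Propositional
  using (_↭_; prep; swap; ↭-refl; ↭-sym; ↭-trans)
open import Data.List.Relation.Binary.Permutation.Propositional.Properties using (All-resp-↭; ∈-resp-↭)
open import Data.List.Relation.Unary.All as All using (All; []; _∷_)
import Data.List.Relation.Unary.All.Properties as All
open import Data.List.Relation.Unary.AllPairs using (AllPairs; []; _∷_)
open import Data.List.Relation.Unary.Any as Any using (Any; here; there)
open import Data.Maybe.Base using (just; nothing)
open import Data.Nat.Base as ℕ using (ℕ; zero; suc; NonZero)
import Data.Nat.Properties as ℕ
open import Data.Product.Base using (_×_; _,_; proj₁; proj₂; ∃; ∃-syntax)
open import Data.Sum.Base using (_⊎_; inj₁; inj₂; [_,_]′)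
open import Data.Unit.Base using (tt)
open import Function.Base using (_∘_)
open import Function.Bundles using (Inverse)
open import Level using (Level)
open import Relation.Binary.Bundles using (Poset)
open import Relation.Binary.Definitions using (DecidableEquality; WeaklyDecidable)
open import Relation.Binary.PropositionalEquality as ≡ using (_≡_)
import Relation.Binary.Reasoning.PartialOrder as PosetReasoning
import Relation.Binary.Reasoning.Setoid as SetoidReasoning
open import Relation.Nullary.Decidable using (¬¬-excluded-middle; dec-true)
open import Relation.Nullary.Decidable.Core using (yes; no; does; ¬?; decidable-stable; map′)
open import Relation.Nullary.Negation.Core using (¬_; contradiction)
open import Relation.Unary using (Pred; Decidable)

private variable
  a a′ ℓ : Level
  A B C : Set a

-- A ring solver with integer coefficients.

module IntegerCoefficients {c ℓ} (R : CommutativeRing c ℓ) where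
  open CommutativeRing R
  open RingProperties ring
  open Multiples semiring using (1+×; ×-homo-+; ×1-homo-*) renaming (_×_ to _·_)
  open SetoidReasoning setoid

  -- With this version of multiples, the solver constants for 1 and 2 reduce to `1#` and `2#`, so
  -- normalised goals match the numerals of the statements definitionally.
  fromℤ : ℤ → Carrier
  fromℤ (+ n)    = n · 1#
  fromℤ -[1+ n ] = - (suc n · 1#)

  fromℤ-neg : ∀ i → fromℤ (ℤ.- i) ≈ - fromℤ i
  fromℤ-neg (+ zero)  = sym -0#≈0#
  fromℤ-neg (+ suc n) = refl
  fromℤ-neg -[1+ n ]  = sym (-‿involutive _)

  fromℤ-⊖ : ∀ m n → fromℤ (m ℤ.⊖ n) ≈ m · 1# - (n · 1#)
  fromℤ-⊖ m       zero    = sym (trans (+-congˡ -0#≈0#) (+-identityʳ _))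
  fromℤ-⊖ zero    (suc n) = sym (+-identityˡ _)
  fromℤ-⊖ (suc m) (suc n) = begin
    fromℤ (suc m ℤ.⊖ suc n)   ≡⟨ ≡.cong fromℤ (ℤ.[1+m]⊖[1+n]≡m⊖n m n) ⟩
    fromℤ (m ℤ.⊖ n)           ≈⟨ fromℤ-⊖ m n ⟩
    x - y                     ≈⟨ +-congʳ (+-identityʳ x) ⟨
    (x + 0#) - y              ≈⟨ +-congʳ (+-congˡ (-‿inverseʳ 1#)) ⟨
    (x + (1# - 1#)) - y       ≈⟨ +-congʳ (+-assoc x 1# (- 1#)) ⟨
    ((x + 1#) - 1#) - y       ≈⟨ +-assoc (x + 1#) (- 1#) (- y) ⟩
    (x + 1#) + (- 1# - y)     ≈⟨ +-cong (+-comm x 1#) (-‿+-comm 1# y) ⟩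
    (1# + x) - (1# + y)       ≈⟨ +-cong (1+× m 1#) (-‿cong (1+× n 1#)) ⟨
    suc m · 1# - (suc n · 1#) ∎
    where x = m · 1#
          y = n · 1#

  fromℤ-+ : ∀ i j → fromℤ (i ℤ.+ j) ≈ fromℤ i + fromℤ j
  fromℤ-+ (+ m)    (+ n)    = ×-homo-+ 1# m n
  fromℤ-+ (+ m)    -[1+ n ] = fromℤ-⊖ m (suc n)
  fromℤ-+ -[1+ m ] (+ n)    = trans (fromℤ-⊖ n (suc m)) (+-comm _ _)
  fromℤ-+ -[1+ m ] -[1+ n ] = begin
    - (suc (suc (m ℕ.+ n)) · 1#)   ≈⟨ -‿cong (1+× (suc (m ℕ.+ n)) 1#) ⟩
    - (1# + (suc m ℕ.+ n) · 1#)    ≈⟨ -‿cong (+-congˡ (×-homo-+ 1# (suc m) n)) ⟩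
    - (1# + (suc m · 1# + n · 1#)) ≈⟨ -‿cong (+-assoc _ _ _) ⟨
    - ((1# + suc m · 1#) + n · 1#) ≈⟨ -‿cong (+-congʳ (+-comm _ _)) ⟩
    - ((suc m · 1# + 1#) + n · 1#) ≈⟨ -‿cong (+-assoc _ _ _) ⟩
    - (suc m · 1# + (1# + n · 1#)) ≈⟨ -‿cong (+-congˡ (1+× n 1#)) ⟨
    - (suc m · 1# + suc n · 1#)    ≈⟨ -‿+-comm _ _ ⟨
    - (suc m · 1#) - (suc n · 1#)  ∎

  fromℤ-*⁺ : ∀ m j → fromℤ (+ m ℤ.* j) ≈ m · 1# * fromℤ j
  fromℤ-*⁺ m (+ n)    = begin
    fromℤ (+ m ℤ.* + n)     ≡⟨ ≡.cong fromℤ (ℤ.pos-* m n) ⟨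
    (m ℕ.* n) · 1#          ≈⟨ ×1-homo-* m n ⟩
    (m · 1#) * (n · 1#)     ∎
  fromℤ-*⁺ m -[1+ n ] = begin
    fromℤ (+ m ℤ.* -[1+ n ])         ≡⟨ ≡.cong fromℤ (ℤ.neg-distribʳ-* (+ m) (+ suc n)) ⟨
    fromℤ (ℤ.- (+ m ℤ.* + suc n))    ≈⟨ fromℤ-neg (+ m ℤ.* + suc n) ⟩
    - fromℤ (+ m ℤ.* + suc n)        ≈⟨ -‿cong (fromℤ-*⁺ m (+ suc n)) ⟩
    - (m · 1# * suc n · 1#)          ≈⟨ -‿distribʳ-* _ _ ⟩
    m · 1# * - (suc n · 1#)          ∎

  fromℤ-* : ∀ i j → fromℤ (i ℤ.* j) ≈ fromℤ i * fromℤ j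
  fromℤ-* (+ m)    j = fromℤ-*⁺ m j
  fromℤ-* -[1+ m ] j = begin
    fromℤ (-[1+ m ] ℤ.* j)           ≡⟨ ≡.cong fromℤ (ℤ.neg-distribˡ-* (+ suc m) j) ⟨
    fromℤ (ℤ.- (+ suc m ℤ.* j))      ≈⟨ fromℤ-neg (+ suc m ℤ.* j) ⟩
    - fromℤ (+ suc m ℤ.* j)          ≈⟨ -‿cong (fromℤ-*⁺ (suc m) j) ⟩
    - (suc m · 1# * fromℤ j)         ≈⟨ -‿distribˡ-* _ _ ⟩
    - (suc m · 1#) * fromℤ j         ∎

  morphism : ℤ.+-*-rawRing -Raw-AlmostCommutative⟶ fromCommutativeRing R
  morphism = record
    { ⟦_⟧    = fromℤ
    ; +-homo = fromℤ-+
    ; *-homo = fromℤ-*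
    ; -‿homo = fromℤ-neg
    ; 0-homo = refl
    ; 1-homo = refl
    }

  _≟?_ : WeaklyDecidable (Induced-equivalence morphism)
  i ≟? j with i ℤ.≟ j
  ... | yes i≡j = just (reflexive (≡.cong fromℤ i≡j))
  ... | no  _   = nothing

  module Solver = Algebra.Solver.Ring ℤ.+-*-rawRing (fromCommutativeRing R) morphism _≟?_

-- Classical reasoning towards negated goals.

infixl 1 _>>=_
-- The conclusion is an arbitrary negation. As `x ≤ y` unfolds to one, case distinctions that hold
-- only doubly negated may be used directly in a proof of an inequality.
_>>=_ : ¬ ¬ A → (A → ¬ B) → ¬ B
(¬¬x >>= f) y = ¬¬x λ x → f x y

return : A → ¬ ¬ A
return x k = k x

-- Inequalities, finite sums and maxima over the reals.

module OrderedField {c ℓ₁ ℓ₂} (ℝ : RealNumbers c ℓ₁ ℓ₂) where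
  open RealNumbers ℝ
  open IntegerCoefficients commutativeRing using (module Solver)
  open Solver

  ≤-reflexive : ∀ {x y} → x ≈ y → x ≤ y
  ≤-reflexive x≈y = <-SPO.irrefl (sym x≈y)

  ≤-refl : ∀ {x} → x ≤ x
  ≤-refl = ≤-reflexive refl

  ≤-trans : ∀ {x y z} → x ≤ y → y ≤ z → x ≤ z
  ≤-trans {x} {y} {z} x≤y y≤z z<x = [ y≤z , x≤y ]′ (<-cotrans z<x y)

  ≤-antisym : ∀ {x y} → x ≤ y → y ≤ x → x ≈ y
  ≤-antisym x≤y y≤x = ≮-antisym y≤x x≤y

  <⇒≤ : ∀ {x y} → x < y → x ≤ y
  <⇒≤ = <-SPO.asym

  <-≤-trans : ∀ {x y z} → x < y → y ≤ z → x < z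
  <-≤-trans {x} {y} {z} x<y y≤z = [ (λ x<z → x<z) , (λ z<y → contradiction z<y y≤z) ]′ (<-cotrans x<y z)

  ≤-or-> : ∀ x y → ¬ ¬ (x ≤ y ⊎ y < x)
  ≤-or-> x y k = k (inj₁ (k ∘ inj₂))

  ≤-total : ∀ x y → ¬ ¬ (x ≤ y ⊎ y ≤ x)
  ≤-total x y = ≤-or-> x y >>= λ
    { (inj₁ x≤y) → return (inj₁ x≤y)
    ; (inj₂ y<x) → return (inj₂ (<⇒≤ y<x)) }

  ≤-poset : Poset c ℓ₁ ℓ₂
  ≤-poset = record
    { Carrier        = Carrier
    ; _≈_            = _≈_
    ; _≤_            = _≤_
    ; isPartialOrder = record
      { isPreorder = record
        { isEquivalence = isEquivalence
        ; reflexive     = ≤-reflexive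
        ; trans         = ≤-trans }
      ; antisym    = ≤-antisym } }

  open PosetReasoning ≤-poset

  <-resp : ∀ {x x′ y y′} → x ≈ x′ → y ≈ y′ → x < y → x′ < y′
  <-resp x≈x′ y≈y′ x<y = proj₁ <-SPO.<-resp-≈ y≈y′ (proj₂ <-SPO.<-resp-≈ x≈x′ x<y)

  ≤-resp : ∀ {x x′ y y′} → x ≈ x′ → y ≈ y′ → x ≤ y → x′ ≤ y′
  ≤-resp x≈x′ y≈y′ x≤y y′<x′ = x≤y (<-resp (sym y≈y′) (sym x≈x′) y′<x′)

  +-monoˡ-≤ : ∀ z {x y} → x ≤ y → x + z ≤ y + z
  +-monoˡ-≤ z {x} {y} x≤y y+z<x+z =
    x≤y (<-resp (cancel y) (cancel x) (+-monoˡ-< (- z) y+z<x+z))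
    where
    cancel : ∀ w → w + z - z ≈ w
    cancel w = solve 2 (λ w z → w :+ z :- z := w) refl w z

  +-mono-≤ : ∀ {x y u v} → x ≤ y → u ≤ v → x + u ≤ y + v
  +-mono-≤ {x} {y} {u} {v} x≤y u≤v = begin
    x + u ≤⟨ +-monoˡ-≤ u x≤y ⟩
    y + u ≈⟨ +-comm y u ⟩
    u + y ≤⟨ +-monoˡ-≤ y u≤v ⟩
    v + y ≈⟨ +-comm v y ⟩
    y + v ∎

  +-nonneg : ∀ {x y} → 0# ≤ x → 0# ≤ y → 0# ≤ x + y
  +-nonneg 0≤x 0≤y = ≤-trans (≤-reflexive (sym (+-identityˡ 0#))) (+-mono-≤ 0≤x 0≤y)

  -- Inequalities are mostly proved by exhibiting the difference of their sides.
  ≤-by-gap : ∀ {x y} d → 0# ≤ d → y ≈ x + d → x ≤ y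
  ≤-by-gap {x} {y} d 0≤d y≈x+d = begin
    x      ≈⟨ +-identityʳ x ⟨
    x + 0# ≤⟨ +-mono-≤ ≤-refl 0≤d ⟩
    x + d  ≈⟨ y≈x+d ⟨
    y      ∎

  gap-nonneg : ∀ {x y} → x ≤ y → 0# ≤ y - x
  gap-nonneg {x} {y} x≤y = ≤-trans (≤-reflexive (sym (-‿inverseʳ x))) (+-monoˡ-≤ (- x) x≤y)

  gap-pos : ∀ {x y} → x < y → 0# < y - x
  gap-pos {x} x<y = <-resp (-‿inverseʳ x) refl (+-monoˡ-< (- x) x<y)

  gap-nonneg⁻¹ : ∀ {x y} → 0# ≤ y - x → x ≤ y
  gap-nonneg⁻¹ {x} {y} 0≤y-x = ≤-by-gap (y - x) 0≤y-x
    (solve 2 (λ x y → y := x :+ (y :- x)) refl x y)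

  gap-pos⁻¹ : ∀ {x y} → 0# < y - x → x < y
  gap-pos⁻¹ {x} {y} 0<y-x = <-resp (+-identityˡ x)
    (solve 2 (λ x y → y :- x :+ x := y) refl x y) (+-monoˡ-< x 0<y-x)

  *-monoʳ-≤ : ∀ {z} → 0# ≤ z → ∀ {x y} → x ≤ y → z * x ≤ z * y
  *-monoʳ-≤ {z} 0≤z {x} {y} x≤y = ≤-by-gap (z * (y - x)) (*-nonneg 0≤z (gap-nonneg x≤y))
    (solve 3 (λ x y z → z :* y := z :* x :+ z :* (y :- x)) refl x y z)

  *-monoˡ-≤ : ∀ {z} → 0# ≤ z → ∀ {x y} → x ≤ y → x * z ≤ y * z
  *-monoˡ-≤ 0≤z x≤y = ≤-resp (*-comm _ _) (*-comm _ _) (*-monoʳ-≤ 0≤z x≤y)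

  *-cancelʳ-≤ : ∀ {z} → 0# < z → ∀ {x y} → x * z ≤ y * z → x ≤ y
  *-cancelʳ-≤ {z} 0<z {x} {y} xz≤yz y<x = xz≤yz (gap-pos⁻¹ (<-resp refl
    (solve 3 (λ x y z → (x :- y) :* z := x :* z :- y :* z) refl x y z) (*-pos (gap-pos y<x) 0<z)))

  *-cancelˡ-≤ : ∀ {z} → 0# < z → ∀ {x y} → z * x ≤ z * y → x ≤ y
  *-cancelˡ-≤ 0<z zx≤zy = *-cancelʳ-≤ 0<z (≤-resp (*-comm _ _) (*-comm _ _) zx≤zy)

  neg-nonneg : ∀ {x} → x ≤ 0# → 0# ≤ - x
  neg-nonneg x≤0 = ≤-trans (gap-nonneg x≤0) (≤-reflexive (+-identityˡ _))

  square-nonneg : ∀ x → 0# ≤ x * x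
  square-nonneg x = ≤-total 0# x >>= λ
    { (inj₁ 0≤x) → *-nonneg 0≤x 0≤x
    ; (inj₂ x≤0) → ≤-trans (*-nonneg (neg-nonneg x≤0) (neg-nonneg x≤0))
        (≤-reflexive (solve 1 (λ x → :- x :* :- x := x :* x) refl x)) }

  square-cancel-≤ : ∀ {x y} → 0# ≤ y → x * x ≤ y * y → x ≤ y
  -- The factor `x + y` of the difference of squares is written as `(x - y) + 2y`, whose positivity
  -- follows from `y < x` and `0 ≤ y`.
  square-cancel-≤ {x} {y} 0≤y xx≤yy y<x = xx≤yy (gap-pos⁻¹ (<-resp refl
    (solve 2 (λ x y → (x :- y) :* (x :- y :+ con (+ 2) :* y) := x :* x :- y :* y) refl x y)
    (*-pos 0<x-y (<-≤-trans 0<x-y (≤-by-gap (2# * y) (*-nonneg 0≤2 0≤y) refl)))))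
    where
    0<x-y = gap-pos y<x
    0≤2 : 0# ≤ 2#
    0≤2 = +-nonneg (<⇒≤ 0<1) (<⇒≤ 0<1)

  0≤1 : 0# ≤ 1#
  0≤1 = <⇒≤ 0<1

  0<2 : 0# < 2#
  0<2 = 0<1+ 0<1

  recip-nonneg : ∀ x (0<x : 0# < x) → 0# ≤ recip x 0<x
  recip-nonneg x 0<x = *-cancelʳ-≤ 0<x (≤-resp (sym (zeroˡ x))
    (trans (sym (*-recip x 0<x)) (*-comm _ _)) 0≤1)

  ^-nonneg : ∀ {x} → 0# ≤ x → ∀ n → 0# ≤ x ^ n
  ^-nonneg 0≤x zero    = 0≤1
  ^-nonneg 0≤x (suc n) = *-nonneg 0≤x (^-nonneg 0≤x n)

  infixl 6 _⊓_
  -- Encoding the minimum through the maximum turns "minimum plus maximum equals sum" into a ring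
  -- identity.
  _⊓_ : Carrier → Carrier → Carrier
  x ⊓ y = x + y - (x ⊔ y)

  ⊔≈ʳ : ∀ {x y} → x ≤ y → x ⊔ y ≈ y
  ⊔≈ʳ {x} {y} x≤y = ≤-antisym (⊔-lub x≤y ≤-refl) (y≤x⊔y x y)

  ⊔≈ˡ : ∀ {x y} → y ≤ x → x ⊔ y ≈ x
  ⊔≈ˡ {x} {y} y≤x = ≤-antisym (⊔-lub ≤-refl y≤x) (x≤x⊔y x y)

  ⊔-nonneg : ∀ {x y} → 0# ≤ x → 0# ≤ x ⊔ y
  ⊔-nonneg 0≤x = ≤-trans 0≤x (x≤x⊔y _ _)

  ⊓≤ˡ : ∀ x y → x ⊓ y ≤ x
  ⊓≤ˡ x y = ≤-by-gap (x ⊔ y - y) (gap-nonneg (y≤x⊔y x y))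
    (solve 3 (λ x y m → x := x :+ y :- m :+ (m :- y)) refl x y (x ⊔ y))

  ⊓-nonneg : ∀ {x y} → 0# ≤ x → 0# ≤ y → 0# ≤ x ⊓ y
  ⊓-nonneg {x} {y} 0≤x 0≤y = gap-nonneg (⊔-lub
    (≤-by-gap y 0≤y refl) (≤-by-gap x 0≤x (+-comm x y)))

  syntax ∑ xs (λ x → e) = ∑[ x ∈ xs ] e
  infix 5 ∑
  ∑ : List A → (A → Carrier) → Carrier
  ∑ xs f = sum (map f xs)

  ∑-cong-∈ : (xs : List A) {f g : A → Carrier} → (∀ x → x ∈ xs → f x ≈ g x) → ∑ xs f ≈ ∑ xs g
  ∑-cong-∈ []       f≈g = refl
  ∑-cong-∈ (x ∷ xs) f≈g = +-cong (f≈g x (here ≡.refl)) (∑-cong-∈ xs (λ y → f≈g y ∘ there))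

  ∑-cong : (xs : List A) {f g : A → Carrier} → (∀ x → f x ≈ g x) → ∑ xs f ≈ ∑ xs g
  ∑-cong xs f≈g = ∑-cong-∈ xs (λ x _ → f≈g x)

  ∑-mono : (xs : List A) {f g : A → Carrier} → (∀ x → f x ≤ g x) → ∑ xs f ≤ ∑ xs g
  ∑-mono []       f≤g = ≤-refl
  ∑-mono (x ∷ xs) f≤g = +-mono-≤ (f≤g x) (∑-mono xs f≤g)

  ∑-nonneg : (xs : List A) {f : A → Carrier} → (∀ x → 0# ≤ f x) → 0# ≤ ∑ xs f
  ∑-nonneg []       0≤f = ≤-refl
  ∑-nonneg (x ∷ xs) 0≤f = +-nonneg (0≤f x) (∑-nonneg xs 0≤f)

  term≤∑ : {xs : List A} {f : A → Carrier} → (∀ x → 0# ≤ f x) → ∀ {x} → x ∈ xs → f x ≤ ∑ xs f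
  term≤∑ {xs = _ ∷ xs} 0≤f (here ≡.refl) = ≤-by-gap _ (∑-nonneg xs 0≤f) refl
  term≤∑ {xs = y ∷ xs} 0≤f (there x∈xs) =
    ≤-trans (term≤∑ 0≤f x∈xs) (≤-by-gap _ (0≤f y) (+-comm _ _))

  ∑-zero : (xs : List A) {f : A → Carrier} → (∀ x → f x ≈ 0#) → ∑ xs f ≈ 0#
  ∑-zero []       f≈0 = refl
  ∑-zero (x ∷ xs) f≈0 = trans (+-cong (f≈0 x) (∑-zero xs f≈0)) (+-identityˡ 0#)

  ∑-+ : (xs : List A) (f g : A → Carrier) → (∑[ x ∈ xs ] f x + g x) ≈ ∑ xs f + ∑ xs g
  ∑-+ []       f g = sym (+-identityˡ 0#)
  ∑-+ (x ∷ xs) f g = trans (+-congˡ (∑-+ xs f g))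
    (solve 4 (λ a b c d → a :+ b :+ (c :+ d) := a :+ c :+ (b :+ d)) refl _ _ _ _)

  ∑-*ˡ : (xs : List A) (k : Carrier) (f : A → Carrier) → (∑[ x ∈ xs ] k * f x) ≈ k * ∑ xs f
  ∑-*ˡ []       k f = sym (zeroʳ k)
  ∑-*ˡ (x ∷ xs) k f = trans (+-congˡ (∑-*ˡ xs k f)) (sym (distribˡ k _ _))

  ∑-*ʳ : (xs : List A) (k : Carrier) (f : A → Carrier) → (∑[ x ∈ xs ] f x * k) ≈ ∑ xs f * k
  ∑-*ʳ xs k f = trans (∑-cong xs (λ x → *-comm (f x) k)) (trans (∑-*ˡ xs k f) (*-comm k _))

  ∑-neg : (xs : List A) (f : A → Carrier) → (∑[ x ∈ xs ] - f x) ≈ - ∑ xs f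
  ∑-neg []       f = solve 0 (con (+ 0) := :- con (+ 0)) refl
  ∑-neg (x ∷ xs) f = trans (+-congˡ (∑-neg xs f))
    (solve 2 (λ a b → :- a :+ :- b := :- (a :+ b)) refl _ _)

  ∑-swap : (xs : List A) (ys : List B) (f : A → B → Carrier) →
           (∑[ x ∈ xs ] ∑[ y ∈ ys ] f x y) ≈ (∑[ y ∈ ys ] ∑[ x ∈ xs ] f x y)
  ∑-swap []       ys f = sym (∑-zero ys (λ _ → refl))
  ∑-swap (x ∷ xs) ys f = trans (+-congˡ (∑-swap xs ys f)) (sym (∑-+ ys (f x) _))

  ∑-++ : (xs ys : List A) (f : A → Carrier) → ∑ (xs ++ ys) f ≈ ∑ xs f + ∑ ys f
  ∑-++ []       ys f = sym (+-identityˡ _)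
  ∑-++ (x ∷ xs) ys f = trans (+-congˡ (∑-++ xs ys f)) (sym (+-assoc _ _ _))

  ∑-map : (h : A → B) (xs : List A) (f : B → Carrier) → ∑ (map h xs) f ≈ ∑ xs (f ∘ h)
  ∑-map h []       f = refl
  ∑-map h (x ∷ xs) f = +-congˡ (∑-map h xs f)

  ∑-cartesianProductWith : (h : A → B → C) (xs : List A) (ys : List B) (f : C → Carrier) →
    ∑ (cartesianProductWith h xs ys) f ≈ (∑[ x ∈ xs ] ∑[ y ∈ ys ] f (h x y))
  ∑-cartesianProductWith h []       ys f = refl
  ∑-cartesianProductWith h (x ∷ xs) ys f = trans (∑-++ (map (h x) ys) _ f)
    (+-cong (∑-map (h x) ys f) (∑-cartesianProductWith h xs ys f))

  ∑-* : (xs : List A) (ys : List B) (f : A → Carrier) (g : B → Carrier) →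
        ∑ xs f * ∑ ys g ≈ (∑[ x ∈ xs ] ∑[ y ∈ ys ] f x * g y)
  ∑-* xs ys f g = trans (sym (∑-*ʳ xs _ f)) (∑-cong xs (λ x → sym (∑-*ˡ ys (f x) g)))

  𝟙 : Bool → Carrier
  𝟙 p = if p then 1# else 0#

  𝟙-nonneg : ∀ p → 0# ≤ 𝟙 p
  𝟙-nonneg true  = 0≤1
  𝟙-nonneg false = ≤-refl

  𝟙≤1 : ∀ p → 𝟙 p ≤ 1#
  𝟙≤1 true  = ≤-refl
  𝟙≤1 false = 0≤1

  𝟙-∧ : ∀ p q → 𝟙 (p ∧ q) ≈ 𝟙 p * 𝟙 q
  𝟙-∧ true  q = sym (*-identityˡ _)
  𝟙-∧ false q = sym (zeroˡ _)

  -- An equation is a pair of inequalities, hence of negations, so equations too may be proved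
  -- classically.
  ≈-stable : ∀ {x y} → ¬ ¬ (x ≈ y) → x ≈ y
  ≈-stable ¬¬x≈y = ≤-antisym (¬¬x≈y >>= ≤-reflexive) (¬¬x≈y >>= (≤-reflexive ∘ sym))

  ⊔-comm : ∀ x y → x ⊔ y ≈ y ⊔ x
  ⊔-comm x y = ≤-antisym (⊔-lub (y≤x⊔y y x) (x≤x⊔y y x)) (⊔-lub (y≤x⊔y x y) (x≤x⊔y x y))

  ⊔-cong : ∀ {x x′ y y′} → x ≈ x′ → y ≈ y′ → x ⊔ y ≈ x′ ⊔ y′
  ⊔-cong x≈ y≈ = ≤-antisym
    (⊔-lub (≤-trans (≤-reflexive x≈) (x≤x⊔y _ _)) (≤-trans (≤-reflexive y≈) (y≤x⊔y _ _)))
    (⊔-lub (≤-trans (≤-reflexive (sym x≈)) (x≤x⊔y _ _)) (≤-trans (≤-reflexive (sym y≈)) (y≤x⊔y _ _)))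

  ⊓-cong : ∀ {x x′ y y′} → x ≈ x′ → y ≈ y′ → x ⊓ y ≈ x′ ⊓ y′
  ⊓-cong x≈ y≈ = +-cong (+-cong x≈ y≈) (-‿cong (⊔-cong x≈ y≈))

  -- For pairs ordered in the same direction, one and the same coordinate attains every maximum
  -- involved.
  ⊔-comonotone : ∀ {t} → 0# ≤ t → ∀ {x y u v} → x ≤ y → u ≤ v →
                 (t * x + u) ⊔ (t * y + v) ≈ t * (x ⊔ y) + (u ⊔ v)
  ⊔-comonotone 0≤t x≤y u≤v = trans
    (⊔≈ʳ (+-mono-≤ (*-monoʳ-≤ 0≤t x≤y) u≤v))
    (sym (+-cong (*-congˡ (⊔≈ʳ x≤y)) (⊔≈ʳ u≤v)))

  -- The pairs `(𝟙 p , 𝟙 q)` and `(u , v)` are comonotone: if the indicators differ, the one that is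
  -- off comes with a zero on its side, and if they are equal, either order of `u` and `v` is
  -- compatible.
  ⊔-layer : ∀ {t} → 0# ≤ t → ∀ p q {u v} → 0# ≤ u → 0# ≤ v →
            (p ≡ false → u ≈ 0#) → (q ≡ false → v ≈ 0#) →
            (t * 𝟙 p + u) ⊔ (t * 𝟙 q + v) ≈ t * (𝟙 p ⊔ 𝟙 q) + (u ⊔ v)
  ⊔-layer {t} 0≤t p q {u} {v} 0≤u 0≤v u-off v-off = ≈-stable (comonotone p q u-off v-off >>= λ
    { (inj₁ (p≤q , u≤v)) → return (⊔-comonotone 0≤t p≤q u≤v)
    ; (inj₂ (q≤p , v≤u)) → return (trans (⊔-comm _ _) (trans (⊔-comonotone 0≤t q≤p v≤u)
        (+-cong (*-congˡ (⊔-comm _ _)) (⊔-comm _ _)))) })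
    where
    comonotone : ∀ p q → (p ≡ false → u ≈ 0#) → (q ≡ false → v ≈ 0#) →
                 ¬ ¬ ((𝟙 p ≤ 𝟙 q × u ≤ v) ⊎ (𝟙 q ≤ 𝟙 p × v ≤ u))
    comonotone false true  u-off v-off = return (inj₁ (0≤1 , ≤-trans (≤-reflexive (u-off ≡.refl)) 0≤v))
    comonotone true  false u-off v-off = return (inj₂ (0≤1 , ≤-trans (≤-reflexive (v-off ≡.refl)) 0≤u))
    comonotone false false u-off v-off = ≤-total u v >>= λ
      { (inj₁ u≤v) → return (inj₁ (≤-refl , u≤v))
      ; (inj₂ v≤u) → return (inj₂ (≤-refl , v≤u)) }
    comonotone true  true  u-off v-off = ≤-total u v >>= λ
      { (inj₁ u≤v) → return (inj₁ (≤-refl , u≤v))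
      ; (inj₂ v≤u) → return (inj₂ (≤-refl , v≤u)) }

  ⊓-layer : ∀ {t} → 0# ≤ t → ∀ p q {u v} → 0# ≤ u → 0# ≤ v →
            (p ≡ false → u ≈ 0#) → (q ≡ false → v ≈ 0#) →
            (t * 𝟙 p + u) ⊓ (t * 𝟙 q + v) ≈ t * (𝟙 p ⊓ 𝟙 q) + (u ⊓ v)
  ⊓-layer {t} 0≤t p q {u} {v} 0≤u 0≤v u-off v-off = trans
    (+-congˡ (-‿cong (⊔-layer 0≤t p q 0≤u 0≤v u-off v-off)))
    (solve 7 (λ t x y u v m n → t :* x :+ u :+ (t :* y :+ v) :- (t :* m :+ n)
                             := t :* (x :+ y :- m) :+ (u :+ v :- n)) refl
      t (𝟙 p) (𝟙 q) u v (𝟙 p ⊔ 𝟙 q) (u ⊔ v))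

  𝟙-⊔ : ∀ p q → 𝟙 p ⊔ 𝟙 q ≈ 𝟙 (p ∨ q)
  𝟙-⊔ true  q = ⊔≈ˡ (𝟙≤1 q)
  𝟙-⊔ false q = ⊔≈ʳ (𝟙-nonneg q)

  𝟙-⊓ : ∀ p q → 𝟙 p ⊓ 𝟙 q ≈ 𝟙 (p ∧ q)
  𝟙-⊓ true  q = trans (+-congˡ (-‿cong (⊔≈ˡ (𝟙≤1 q)))) (solve 2 (λ x y → x :+ y :- x := y) refl _ _)
  𝟙-⊓ false q = trans (+-congˡ (-‿cong (⊔≈ʳ (𝟙-nonneg q)))) (solve 1 (λ y → con (+ 0) :+ y :- y := con (+ 0)) refl _)

  ∑-mono-∈ : (xs : List A) {f g : A → Carrier} → (∀ x → x ∈ xs → f x ≤ g x) → ∑ xs f ≤ ∑ xs g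
  ∑-mono-∈ []       f≤g = ≤-refl
  ∑-mono-∈ (x ∷ xs) f≤g = +-mono-≤ (f≤g x (here ≡.refl)) (∑-mono-∈ xs (λ y → f≤g y ∘ there))

  ∑-filter : {P : Pred A ℓ} (P? : Decidable P) (xs : List A) (f : A → Carrier) →
             ∑ (filter P? xs) f ≈ (∑[ x ∈ xs ] 𝟙 (does (P? x)) * f x)
  ∑-filter P? []       f = refl
  ∑-filter P? (x ∷ xs) f with does (P? x)
  ... | true  = +-cong (sym (*-identityˡ _)) (∑-filter P? xs f)
  ... | false = trans (∑-filter P? xs f) (sym (trans (+-congʳ (zeroˡ _)) (+-identityˡ _)))

  -- Insertion sort by a real-valued key, up to double negation.

  module _ {V : Set a} (μ : V → Carrier) where

    Sorted : List V → Set _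
    Sorted = AllPairs (λ v w → μ v ≤ μ w)

    insert : ∀ v ws → Sorted ws → ¬ ¬ (∃[ ws′ ] ws′ ↭ v ∷ ws × Sorted ws′)
    insert v []       []                = return (v ∷ [] , ↭-refl , [] ∷ [])
    insert v (w ∷ ws) (w≤ws ∷ ws-sorted) = ≤-total (μ v) (μ w) >>= λ
      { (inj₁ v≤w) → return (v ∷ w ∷ ws , ↭-refl ,
          (v≤w ∷ All.map (≤-trans v≤w) w≤ws) ∷ w≤ws ∷ ws-sorted)
      ; (inj₂ w≤v) → insert v ws ws-sorted >>= λ { (ws′ , ws′↭ , ws′-sorted) →
          return (w ∷ ws′ , ↭-trans (prep w ws′↭) (swap w v ↭-refl) ,
            All-resp-↭ (↭-sym ws′↭) (w≤v ∷ w≤ws) ∷ ws′-sorted) } }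

    sort : ∀ vs → ¬ ¬ (∃[ ws ] ws ↭ vs × Sorted ws)
    sort []       = return ([] , ↭-refl , [])
    sort (v ∷ vs) = sort vs >>= λ { (ws , ws↭vs , ws-sorted) →
      insert v ws ws-sorted >>= λ { (ws′ , ws′↭ , ws′-sorted) →
      return (ws′ , ↭-trans ws′↭ (prep v ws↭vs) , ws′-sorted) } }

  -- Complementary slackness: nonpositive terms with a nonnegative sum are each nonnegative, so the
  -- implication applies term by term.
  ∑-slack : (xs : List A) (f g : A → Carrier) →
            (∀ x → f x ≤ 0#) → (∀ x → 0# ≤ f x → g x ≤ 0#) → 0# ≤ ∑ xs f → ∑ xs g ≤ 0#
  ∑-slack []       f g f≤0 g≤0 0≤∑ = ≤-refl
  ∑-slack (x ∷ xs) f g f≤0 g≤0 0≤∑ = ≤-trans (+-mono-≤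
      (g≤0 x (≤-trans 0≤∑ (≤-trans (+-mono-≤ ≤-refl ∑f≤0) (≤-reflexive (+-identityʳ _)))))
      (∑-slack xs f g f≤0 g≤0 (≤-trans 0≤∑ (≤-trans (+-mono-≤ (f≤0 x) ≤-refl) (≤-reflexive (+-identityˡ _))))))
    (≤-reflexive (+-identityˡ 0#))
    where
    ∑f≤0 : ∑ xs f ≤ 0#
    ∑f≤0 = ≤-trans (∑-mono xs f≤0) (≤-reflexive (∑-zero xs (λ _ → refl)))

  max₀-upper : ∀ {n} (x : Fin n → Carrier) i → x i ≤ max₀ x
  max₀-upper x zero    = x≤x⊔y _ _
  max₀-upper x (suc i) = ≤-trans (max₀-upper (x ∘ suc) i) (y≤x⊔y _ _)

  max₀-least : ∀ {n} (x : Fin n → Carrier) {y} → 0# ≤ y → (∀ i → x i ≤ y) → max₀ x ≤ y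
  max₀-least {zero}  x 0≤y x≤y = 0≤y
  max₀-least {suc n} x 0≤y x≤y = ⊔-lub (x≤y zero) (max₀-least (x ∘ suc) 0≤y (x≤y ∘ suc))

  argmax : (f : A → Carrier) (x₀ : A) (xs : List A) → ¬ ¬ (∃[ x ] f x₀ ≤ f x × ∀ y → y ∈ xs → f y ≤ f x)
  argmax f x₀ []       = return (x₀ , ≤-refl , λ _ ())
  argmax f x₀ (y ∷ ys) = argmax f x₀ ys >>= λ { (x , x₀≤x , ys≤x) → ≤-total (f y) (f x) >>= λ
    { (inj₁ y≤x) → return (x , x₀≤x , λ { _ (here ≡.refl) → y≤x ; z (there z∈) → ys≤x z z∈ })
    ; (inj₂ x≤y) → return (y , ≤-trans x₀≤x x≤y ,
        λ { _ (here ≡.refl) → ≤-refl ; z (there z∈) → ≤-trans (ys≤x z z∈) x≤y }) } }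

  -- This forces ι = w⁻¹ when w > 0 and says nothing when w = 0, yet it is stable under products.
  GeneralisedInverse : Carrier → Carrier → Set _
  GeneralisedInverse w ι = 0# ≤ ι × ι * (w * w) ≈ w

  generalisedInverse : ∀ w → 0# ≤ w → ¬ ¬ (∃ (GeneralisedInverse w))
  generalisedInverse w 0≤w = ≤-or-> w 0# >>= λ
    { (inj₁ w≤0) → return (0# , ≤-refl , trans (zeroˡ _) (≤-antisym 0≤w w≤0))
    ; (inj₂ 0<w) → return (recip w 0<w , recip-nonneg w 0<w ,
        trans (solve 2 (λ i w → i :* (w :* w) := w :* i :* w) refl _ w)
          (trans (*-congʳ (*-recip w 0<w)) (*-identityˡ w))) }

  -- If `w` is positive then `ι * w` is 1. If `w` is zero then so is `x`, being squeezed between 0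
  -- and `w`.
  absorb : ∀ {w ι x} → GeneralisedInverse w ι → 0# ≤ x → x ≤ w → ι * (w * x) ≈ x
  absorb {w} {ι} {x} (0≤ι , ιww≈w) 0≤x x≤w = ≈-stable (≤-or-> w 0# >>= λ
    { (inj₁ w≤0) → return (let x≈0 = ≤-antisym (≤-trans x≤w w≤0) 0≤x in
        trans (*-congˡ (*-congˡ x≈0)) (trans (solve 2 (λ i w → i :* (w :* con (+ 0)) := con (+ 0)) refl ι w) (sym x≈0)))
    ; (inj₂ 0<w) → return (trans (sym (*-assoc ι w x)) (trans (*-congʳ (ιw≈1 0<w)) (*-identityˡ x))) })
    where
    ιw≈1 : 0# < w → ι * w ≈ 1#
    ιw≈1 0<w = ≤-antisym (*-cancelʳ-≤ 0<w (≤-reflexive eq)) (*-cancelʳ-≤ 0<w (≤-reflexive (sym eq)))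
      where
      eq : ι * w * w ≈ 1# * w
      eq = trans (*-assoc ι w w) (trans ιww≈w (sym (*-identityˡ w)))

-- Layer-cake decomposition and correlated sampling.

module CorrelatedSampling {c ℓ₁ ℓ₂} (ℝ : RealNumbers c ℓ₁ ℓ₂) where
  open RealNumbers ℝ
  open OrderedField ℝ
  open IntegerCoefficients commutativeRing using (module Solver)
  open Solver
  open PosetReasoning ≤-poset

  module LayerCake {V : Set a} (_≟_ : DecidableEquality V) (vs : List V) (complete : ∀ v → v ∈ vs)
                   {I : Set a′} (s t : I → V) (P : List I) where
    open DecMembership _≟_ using (_∈?_)

    -- min and max are additive along the level sets of μ, so L κ R μ is a nonnegative
    -- combination of the values of L κ R at indicator functions of level sets.
    L : (κ R : I → Carrier) → (V → Carrier) → Carrier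
    L κ R μ = ∑[ i ∈ P ] κ i * (μ (s i) ⊓ μ (t i)) - (R i * (μ (s i) ⊔ μ (t i)))

    L-cong : ∀ κ R {μ ν} → (∀ v → μ v ≈ ν v) → L κ R μ ≈ L κ R ν
    L-cong κ R μ≈ν = ∑-cong P λ i →
      +-cong (*-congˡ (⊓-cong (μ≈ν _) (μ≈ν _))) (-‿cong (*-congˡ (⊔-cong (μ≈ν _) (μ≈ν _))))

    L-layer : ∀ κ R {τ} → 0# ≤ τ → ∀ (T : V → Bool) {ν} → (∀ v → 0# ≤ ν v) →
              (∀ v → T v ≡ false → ν v ≈ 0#) →
              L κ R (λ v → τ * 𝟙 (T v) + ν v) ≈ τ * L κ R (𝟙 ∘ T) + L κ R ν
    L-layer κ R {τ} 0≤τ T {ν} 0≤ν ν-off = trans (∑-cong P λ i → trans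
        (+-cong (*-congˡ (⊓-layer 0≤τ (T (s i)) (T (t i)) (0≤ν _) (0≤ν _) (ν-off _) (ν-off _)))
          (-‿cong (*-congˡ (⊔-layer 0≤τ (T (s i)) (T (t i)) (0≤ν _) (0≤ν _) (ν-off _) (ν-off _)))))
        (solve 7 (λ κ R τ x y u v → κ :* (τ :* x :+ u) :- R :* (τ :* y :+ v)
                    := τ :* (κ :* x :- R :* y) :+ (κ :* u :- R :* v)) refl
          (κ i) (R i) τ _ _ _ _))
      (trans (∑-+ P _ _) (+-congʳ (∑-*ˡ P τ _)))

    -- With these coefficients the minima drop out and `L` becomes the sum of `μ (s i) ⊔ μ (t i)`
    -- over `P`. It measures how much of `P` is touched by `μ`.
    Z : (V → Carrier) → Carrier
    Z = L (λ _ → 0#) (λ _ → - 1#)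

    module _ (κ R : I → Carrier)
             (sets : ∀ T → L κ R (𝟙 ∘ T) ≤ 0# × (0# ≤ L κ R (𝟙 ∘ T) → Z (𝟙 ∘ T) ≤ 0#))
             (μ : V → Carrier) where

      -- The part of `μ` above height `τ`, when `ws` lists the vertices that reach beyond it.
      trunc : List V → Carrier → V → Carrier
      trunc ws τ v = 𝟙 (does (v ∈? ws)) * (μ v - τ)

      trunc-nonneg : ∀ {τ} ws → All (λ w → τ ≤ μ w) ws → ∀ v → 0# ≤ trunc ws τ v
      trunc-nonneg ws τ≤ws v with v ∈? ws
      ... | yes v∈ws = *-nonneg 0≤1 (gap-nonneg (All.lookup τ≤ws v∈ws))
      ... | no  _    = ≤-reflexive (sym (zeroˡ _))

      trunc-layer : ∀ τ w ws v → trunc (w ∷ ws) τ v ≈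
                    (μ w - τ) * 𝟙 (does (v ∈? (w ∷ ws))) + trunc ws (μ w) v
      trunc-layer τ w ws v with v ≟ w | v ∈? ws
      ... | yes ≡.refl | yes _ = solve 2 (λ x y → con (+ 1) :* (x :- y) :=
                                  (x :- y) :* con (+ 1) :+ con (+ 1) :* (x :- x)) refl _ _
      ... | yes ≡.refl | no  _ = solve 2 (λ x y → con (+ 1) :* (x :- y) :=
                                  (x :- y) :* con (+ 1) :+ con (+ 0) :* (x :- x)) refl _ _
      ... | no  _      | yes _ = solve 3 (λ x y z → con (+ 1) :* (x :- y) :=
                                  (z :- y) :* con (+ 1) :+ con (+ 1) :* (x :- z)) refl _ _ _
      ... | no  _      | no  _ = solve 3 (λ x y z → con (+ 0) :* (x :- y) :=
                                  (z :- y) :* con (+ 0) :+ con (+ 0) :* (x :- z)) refl _ _ _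

      trunc-off : ∀ τ w ws v → does (v ∈? (w ∷ ws)) ≡ false → trunc ws τ v ≈ 0#
      trunc-off τ w ws v off with v ≟ w | v ∈? ws
      ... | no _ | no _ = zeroˡ _

      -- Induction along the increasing order of `μ`: the part above `τ` is a layer of height
      -- `μ w - τ` over `w ∷ ws` plus the part above `μ w`. All layers contribute at most 0 to `L`,
      -- so a nonnegative total makes each contribution tight.
      layers : ∀ τ ws → All (λ w → τ ≤ μ w) ws → Sorted μ ws →
               let ν = trunc ws τ in L κ R ν ≤ 0# × (0# ≤ L κ R ν → Z ν ≤ 0#)
      layers τ [] [] [] = ≤-reflexive (L-zero κ R) , λ _ → ≤-reflexive (L-zero _ _)
        where
        L-zero : ∀ κ R → L κ R (trunc [] τ) ≈ 0#
        L-zero κ R = ∑-zero P λ i → trans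
          (+-cong (*-congˡ (trans (⊓-cong (zeroˡ _) (zeroˡ _)) (𝟙-⊓ false false)))
                  (-‿cong (*-congˡ (trans (⊔-cong (zeroˡ _) (zeroˡ _)) (𝟙-⊔ false false)))))
          (solve 2 (λ x y → x :* con (+ 0) :- y :* con (+ 0) := con (+ 0)) refl (κ i) (R i))
      layers τ (w ∷ ws) τ≤@(τ≤w ∷ _) (w≤ws ∷ ws-sorted) =
        ≤-trans (≤-reflexive (decompose κ R)) (≤-trans (+-mono-≤ head≤0 tail≤0) (≤-reflexive (+-identityˡ 0#))) ,
        λ 0≤L → ≤-trans (≤-reflexive (decompose _ _)) (≤-trans (+-mono-≤
          (head-tight (≤-trans 0≤L (≤-trans (≤-reflexive (decompose κ R))
            (≤-trans (+-mono-≤ ≤-refl tail≤0) (≤-reflexive (+-identityʳ _))))))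
          (proj₂ rec (≤-trans 0≤L (≤-trans (≤-reflexive (decompose κ R))
            (≤-trans (+-mono-≤ head≤0 ≤-refl) (≤-reflexive (+-identityˡ _)))))))
          (≤-reflexive (+-identityˡ 0#)))
        where
        T : V → Bool
        T v = does (v ∈? (w ∷ ws))
        ν = trunc ws (μ w)
        rec = layers (μ w) ws w≤ws ws-sorted
        tail≤0 = proj₁ rec
        0≤δ : 0# ≤ μ w - τ
        0≤δ = gap-nonneg τ≤w
        decompose : ∀ κ R → L κ R (trunc (w ∷ ws) τ) ≈ (μ w - τ) * L κ R (𝟙 ∘ T) + L κ R ν
        decompose κ R = trans (L-cong κ R (trunc-layer τ w ws))
          (L-layer κ R 0≤δ T (trunc-nonneg ws w≤ws) (trunc-off (μ w) w ws))
        head≤0 : (μ w - τ) * L κ R (𝟙 ∘ T) ≤ 0#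
        head≤0 = ≤-trans (*-monoʳ-≤ 0≤δ (proj₁ (sets T))) (≤-reflexive (zeroʳ _))
        head-tight : 0# ≤ (μ w - τ) * L κ R (𝟙 ∘ T) → (μ w - τ) * Z (𝟙 ∘ T) ≤ 0#
        -- A layer of height zero adds nothing to `Z`; a positive height cancels, and the tightness
        -- clause of `sets` applies to `T`.
        head-tight 0≤δL = ≤-or-> (μ w - τ) 0# >>= λ
          { (inj₁ δ≤0) → ≤-reflexive (trans (*-congʳ (≤-antisym δ≤0 0≤δ)) (zeroˡ _))
          ; (inj₂ 0<δ) → ≤-trans (*-monoʳ-≤ 0≤δ (proj₂ (sets T)
              (*-cancelˡ-≤ 0<δ (≤-trans (≤-reflexive (zeroʳ _)) 0≤δL)))) (≤-reflexive (zeroʳ _)) }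

      layer-cake : (∀ v → 0# ≤ μ v) → L κ R μ ≤ 0# × (0# ≤ L κ R μ → Z μ ≤ 0#)
      layer-cake 0≤μ =
        (sorted >>= (proj₁ ∘ finish)) , λ 0≤L → sorted >>= λ x → proj₂ (finish x) 0≤L
        where
        sorted = sort μ vs
        finish : ∃[ ws ] ws ↭ vs × Sorted μ ws → L κ R μ ≤ 0# × (0# ≤ L κ R μ → Z μ ≤ 0#)
        finish (ws , ws↭vs , ws-sorted) =
          ≤-trans (≤-reflexive (L-cong κ R μ≈)) (proj₁ bound) ,
          λ 0≤L → ≤-trans (≤-reflexive (L-cong _ _ μ≈))
            (proj₂ bound (≤-trans 0≤L (≤-reflexive (L-cong κ R μ≈))))
          where
          bound = layers 0# ws (All.universal 0≤μ ws) ws-sorted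
          μ≈ : ∀ v → μ v ≈ trunc ws 0# v
          μ≈ v with v ∈? ws
          ... | yes _    = solve 1 (λ x → x := con (+ 1) :* (x :- con (+ 0))) refl (μ v)
          ... | no  v∉ws = contradiction (∈-resp-↭ (↭-sym ws↭vs) (complete v)) v∉ws

  -- Derandomised rounding of labels by level sets.

  module Rounding {v σ i o : Level}
    {V : Set v} (_≟_ : DecidableEquality V) (vs : List V) (complete : ∀ v → v ∈ vs)
    {S : Set σ} (g₀ : V → S)
    {I : Set i} (s t : I → V)
    (val : I → S → S → Carrier) (0≤val : ∀ i x y → 0# ≤ val i x y)
    {Ω : Set o} (ωs : List Ω) (q : Ω → Carrier) (0≤q : ∀ ω → 0# ≤ q ω)
    (μ : V → Ω → Carrier) (0≤μ : ∀ v ω → 0# ≤ μ v ω)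
    (label : V → Ω → S)
    (R : I → Carrier)
    where

    κ : Ω → I → Carrier
    κ ω i = val i (label (s i) ω) (label (t i) ω)

    union common : I → Carrier
    union  i = ∑[ ω ∈ ωs ] q ω * (μ (s i) ω ⊔ μ (t i) ω)
    common i = ∑[ ω ∈ ωs ] q ω * (κ ω i * (μ (s i) ω ⊓ μ (t i) ω))

    -- When (ω , T) is drawn with T a random level set of μ at ω, a pair i is touched at rate
    -- union i and earns value at rate common i, so it can be promised the value R i.
    Affordable : I → Set _
    Affordable i = R i * union i ≤ common i × (union i ≤ 0# → R i ≤ 0#)

    module _ (T : V → Bool) where

      touched : I → Bool
      touched i = T (s i) ∨ T (t i)

      untouched? : Decidable (λ i → touched i ≡ false)
      untouched? i = touched i ≟ᵇ false

      overwrite : Ω → (V → S) → V → S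
      overwrite ω g v = if T v then label v ω else g v

      -- A pair inside `T` earns its value under the labels at `ω`, and a pair outside keeps its
      -- value under `g`. For a pair with only one end in `T` the left side is 0, and `0≤val`
      -- suffices.
      overwrite-wins : ∀ ω g i →
        κ ω i * (𝟙 (T (s i)) ⊓ 𝟙 (T (t i))) + 𝟙 (does (untouched? i)) * val i (g (s i)) (g (t i))
          ≤ val i (overwrite ω g (s i)) (overwrite ω g (t i))
      overwrite-wins ω g i with T (s i) | T (t i)
      ... | true  | true  = ≤-reflexive (trans (+-congʳ (*-congˡ (𝟙-⊓ true true)))
        (solve 2 (λ x y → x :* con (+ 1) :+ con (+ 0) :* y := x) refl _ _))
      ... | true  | false = ≤-trans (≤-reflexive (trans (+-congʳ (*-congˡ (𝟙-⊓ true false)))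
        (solve 2 (λ x y → x :* con (+ 0) :+ con (+ 0) :* y := con (+ 0)) refl _ _))) (0≤val i _ _)
      ... | false | true  = ≤-trans (≤-reflexive (trans (+-congʳ (*-congˡ (𝟙-⊓ false true)))
        (solve 2 (λ x y → x :* con (+ 0) :+ con (+ 0) :* y := con (+ 0)) refl _ _))) (0≤val i _ _)
      ... | false | false = ≤-reflexive (trans (+-congʳ (*-congˡ (𝟙-⊓ false false)))
        (solve 2 (λ x y → x :* con (+ 0) :+ con (+ 1) :* y := y) refl _ _))

      split-R : ∀ i → R i ≈ R i * (𝟙 (T (s i)) ⊔ 𝟙 (T (t i))) + 𝟙 (does (untouched? i)) * R i
      split-R i with T (s i) | T (t i)
      ... | true  | q     = sym (trans (+-congʳ (*-congˡ (𝟙-⊔ true q)))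
        (solve 1 (λ x → x :* con (+ 1) :+ con (+ 0) :* x := x) refl _))
      ... | false | true  = sym (trans (+-congʳ (*-congˡ (𝟙-⊔ false true)))
        (solve 1 (λ x → x :* con (+ 1) :+ con (+ 0) :* x := x) refl _))
      ... | false | false = sym (trans (+-congʳ (*-congˡ (𝟙-⊔ false false)))
        (solve 1 (λ x → x :* con (+ 0) :+ con (+ 1) :* x := x) refl _))

    module _ (P : List I) where
      open LayerCake _≟_ vs complete s t P

      -- Reading off a labelling from the level set T at ω pays for all pairs that T touches.
      Good : Set _
      Good = ∃[ ω ] ∃[ T ] Any (λ i → ¬ touched T i ≡ false) P × 0# ≤ L (κ ω) R (𝟙 ∘ T)

      -- The promises to the pairs that `T` touches are covered by `0 ≤ L`; those to the other pairs
      -- are kept by `g`, which `overwrite` does not alter there.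
      extend : ∀ ω T → 0# ≤ L (κ ω) R (𝟙 ∘ T) → ∀ g →
        let P′ = filter (untouched? T) P ; g′ = overwrite T ω g in
        ∑ P′ R ≤ (∑[ i ∈ P′ ] val i (g (s i)) (g (t i))) →
        ∑ P R ≤ (∑[ i ∈ P ] val i (g′ (s i)) (g′ (t i)))
      extend ω T 0≤L g ∑R≤∑val = begin
        ∑ P R
          ≈⟨ ∑-cong P (split-R T) ⟩
        (∑[ i ∈ P ] R i * U i + 𝟙 (does (untouched? T i)) * R i)
          ≈⟨ ∑-+ P _ _ ⟩
        (∑[ i ∈ P ] R i * U i) + (∑[ i ∈ P ] 𝟙 (does (untouched? T i)) * R i)
          ≈⟨ +-congˡ (∑-filter (untouched? T) P R) ⟨
        (∑[ i ∈ P ] R i * U i) + ∑ (filter (untouched? T) P) R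
          ≤⟨ +-mono-≤ inside ∑R≤∑val ⟩
        (∑[ i ∈ P ] κ ω i * N i) + (∑[ i ∈ filter (untouched? T) P ] val i (g (s i)) (g (t i)))
          ≈⟨ +-congˡ (∑-filter (untouched? T) P _) ⟩
        (∑[ i ∈ P ] κ ω i * N i) + (∑[ i ∈ P ] 𝟙 (does (untouched? T i)) * val i (g (s i)) (g (t i)))
          ≈⟨ ∑-+ P _ _ ⟨
        (∑[ i ∈ P ] κ ω i * N i + 𝟙 (does (untouched? T i)) * val i (g (s i)) (g (t i)))
          ≤⟨ ∑-mono P (overwrite-wins T ω g) ⟩
        (∑[ i ∈ P ] val i (overwrite T ω g (s i)) (overwrite T ω g (t i))) ∎
        where
        U N : I → Carrier
        U i = 𝟙 (T (s i)) ⊔ 𝟙 (T (t i))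
        N i = 𝟙 (T (s i)) ⊓ 𝟙 (T (t i))
        inside : (∑[ i ∈ P ] R i * U i) ≤ (∑[ i ∈ P ] κ ω i * N i)
        inside = gap-nonneg⁻¹ (≤-trans 0≤L (≤-reflexive
          (trans (∑-+ P _ _) (+-congˡ (∑-neg P _)))))

      -- A set touching some pair of `P` cannot have `0 ≤ L`, as it would be good; for a set
      -- touching none, `L` and `Z` are both 0. This is the hypothesis of `layer-cake`.
      bad-sets : ¬ Good → ∀ ω T →
        L (κ ω) R (𝟙 ∘ T) ≤ 0# × (0# ≤ L (κ ω) R (𝟙 ∘ T) → Z (𝟙 ∘ T) ≤ 0#)
      bad-sets ¬good ω T with Any.any? (λ i → ¬? (untouched? T i)) P
      ... | yes touch = (λ 0<L → ¬good (ω , T , touch , <⇒≤ 0<L)) , λ 0≤L _ → ¬good (ω , T , touch , 0≤L)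
      ... | no  avoid = ≤-reflexive (L-zero _ _) , λ _ → ≤-reflexive (L-zero _ _)
        where
        off : ∀ i → touched T i ≡ false → 𝟙 (T (s i)) ⊓ 𝟙 (T (t i)) ≈ 0# × 𝟙 (T (s i)) ⊔ 𝟙 (T (t i)) ≈ 0#
        off i eq with T (s i) | T (t i)
        ... | false | false = 𝟙-⊓ false false , 𝟙-⊔ false false
        L-zero : ∀ κ R → L κ R (𝟙 ∘ T) ≈ 0#
        L-zero κ R = trans (∑-cong-∈ P {g = λ _ → 0#} λ i i∈P →
          let eq = decidable-stable (untouched? T i) (λ ne → avoid (lose i∈P ne)) in
          trans (+-cong (*-congˡ (proj₁ (off i eq))) (-‿cong (*-congˡ (proj₂ (off i eq)))))
            (solve 2 (λ x y → x :* con (+ 0) :- y :* con (+ 0) := con (+ 0)) refl (κ i) (R i)))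
          (∑-zero P (λ _ → refl))

      -- The coefficients are arbitrary because the identity is applied to `Z` as well.
      average : ∀ (κ : Ω → I → Carrier) R → (∑[ ω ∈ ωs ] q ω * L (κ ω) R (λ v → μ v ω)) ≈
        (∑[ i ∈ P ] (∑[ ω ∈ ωs ] q ω * (κ ω i * (μ (s i) ω ⊓ μ (t i) ω))) - (R i * union i))
      average κ R = trans (∑-cong ωs (λ ω → sym (∑-*ˡ P (q ω) _)))
        (trans (∑-swap ωs P _) (∑-cong P λ i → trans
          (∑-cong ωs (λ ω → solve 5 (λ q κ x R y → q :* (κ :* x :- R :* y) := q :* (κ :* x) :+ (:- R) :* (q :* y))
            refl (q ω) (κ ω i) (μ (s i) ω ⊓ μ (t i) ω) (R i) _))
          (trans (∑-+ ωs _ _) (+-congˡ (trans (∑-*ˡ ωs (- R i) _)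
            (solve 2 (λ R y → (:- R) :* y := :- (R :* y)) refl (R i) _))))))

      -- Affordability makes the average of `L` over `ω` nonnegative, whereas without good sets
      -- every `L` is nonpositive. So all are tight, `Z` vanishes wherever `q ω` is positive, and
      -- hence so does `union` on `P`; the second clause of `Affordable` then applies.
      no-good⇒null : All Affordable P → ¬ Good → ∑ P R ≤ 0#
      no-good⇒null affordable ¬good = ≤-trans
        (∑-mono-∈ P {g = λ _ → 0#} λ i i∈P → proj₂ (All.lookup affordable i∈P) (≤-trans (term≤∑ 0≤union i∈P) ∑union≤0))
        (≤-reflexive (∑-zero P (λ _ → refl)))
        where
        bound : ∀ ω → _
        bound ω = layer-cake (κ ω) R (bad-sets ¬good ω) (λ v → μ v ω) (λ v → 0≤μ v ω)
        0≤union : ∀ i → 0# ≤ union i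
        0≤union i = ∑-nonneg ωs λ ω → *-nonneg (0≤q ω) (⊔-nonneg (0≤μ _ _))
        0≤∑ : 0# ≤ (∑[ ω ∈ ωs ] q ω * L (κ ω) R (λ v → μ v ω))
        0≤∑ = ≤-trans
          (≤-trans (≤-reflexive (sym (∑-zero P (λ _ → refl))))
            (∑-mono-∈ P {f = λ _ → 0#} (λ i i∈P → gap-nonneg (proj₁ (All.lookup affordable i∈P)))))
          (≤-reflexive (sym (average κ R)))
        tight : ∀ ω → 0# ≤ q ω * L (κ ω) R (λ v → μ v ω) → q ω * Z (λ v → μ v ω) ≤ 0#
        tight ω 0≤qL = ≤-or-> (q ω) 0# >>= λ
          { (inj₁ q≤0) → ≤-reflexive (trans (*-congʳ (≤-antisym q≤0 (0≤q ω))) (zeroˡ _))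
          ; (inj₂ 0<q) → ≤-trans (*-monoʳ-≤ (0≤q ω) (proj₂ (bound ω)
              (*-cancelˡ-≤ 0<q (≤-trans (≤-reflexive (zeroʳ _)) 0≤qL)))) (≤-reflexive (zeroʳ _)) }
        ∑union≤0 : ∑ P union ≤ 0#
        ∑union≤0 = begin
          ∑ P union
            ≈⟨ ∑-cong P (λ i → trans (solve 1 (λ u → u := con (+ 0) :- (:- con (+ 1)) :* u) refl (union i))
                 (+-congʳ (sym (∑-zero ωs (λ ω → solve 2 (λ q x → q :* (con (+ 0) :* x) := con (+ 0)) refl (q ω) _))))) ⟩
          _
            ≈⟨ average (λ _ _ → 0#) (λ _ → - 1#) ⟨
          (∑[ ω ∈ ωs ] q ω * Z (λ v → μ v ω))
            ≤⟨ ∑-slack ωs _ _ (λ ω → ≤-trans (*-monoʳ-≤ (0≤q ω) (proj₁ (bound ω))) (≤-reflexive (zeroʳ _))) tight 0≤∑ ⟩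
          0# ∎

    -- Greedy choice: a good level set pays for the pairs it touches, the others are labelled
    -- recursively, and the labels at `ω` overwrite the result on `T`. At least one pair is removed
    -- each time, so the length bound `n` drives the recursion. Once no good set is left, the
    -- promises total at most 0 and `g₀` will do.
    round : ∀ n P → length P ℕ.≤ n → All Affordable P →
            ¬ ¬ (∃[ g ] ∑ P R ≤ (∑[ i ∈ P ] val i (g (s i)) (g (t i))))
    round n       []         _   _          = return (g₀ , ≤-refl)
    round (suc n) P@(_ ∷ _) |P|≤ affordable = ¬¬-excluded-middle >>= λ
      { (no ¬good) → return (g₀ , ≤-trans (no-good⇒null P affordable ¬good) (∑-nonneg P (λ i → 0≤val i _ _)))
      ; (yes (ω , T , touch , 0≤L)) →
          round n (filter (untouched? T) P)
            (ℕ.≤-pred (ℕ.≤-trans (filter-notAll (untouched? T) P touch) |P|≤))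
              (All.filter⁺ (untouched? T) affordable) >>= λ { (g , g-wins) →
          return (overwrite T ω g , extend P ω T 0≤L g g-wins) } }

-- Finite sets: enumeration and finite choice under double negation.

¬¬-Fin : ∀ {n} {P : Fin n → Set ℓ} → (∀ i → ¬ ¬ P i) → ¬ ¬ (∀ i → P i)
¬¬-Fin {n = zero}  ¬¬P = return λ ()
¬¬-Fin {n = suc n} ¬¬P = ¬¬P zero >>= λ P₀ → ¬¬-Fin (¬¬P ∘ suc) >>= λ P₊ →
  return λ { zero → P₀ ; (suc i) → P₊ i }

module _ (X : FinSet) where
  open FinSet X

  element-index : ∀ x → element (index x) ≡ x
  element-index x = Inverse.strictlyInverseʳ enum x

  index-element : ∀ i → index (element i) ≡ i
  index-element i = Inverse.strictlyInverseˡ enum i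

  -- Abstract because with-abstractions over it fail once it unfolds.
  abstract
    _≟ᶠ_ : DecidableEquality Element
    _≟ᶠ_ x y = map′
      (λ eq → ≡.trans (≡.sym (element-index x)) (≡.trans (≡.cong element eq) (element-index y)))
      (≡.cong index) (index x Fin.≟ index y)

  elements : List Element
  elements = tabulate element

  ∈-elements : ∀ x → x ∈ elements
  ∈-elements x = ≡.subst (_∈ elements) (element-index x) (∈-tabulate⁺ (index x))

  ¬¬-choice : {P : Element → B → Set ℓ} → (∀ x → ¬ ¬ (∃ (P x))) → ¬ ¬ (∃[ f ] ∀ x → P x (f x))
  ¬¬-choice {P = P} ¬¬P = ¬¬-Fin (¬¬P ∘ element) >>= λ Pᵢ →
    return ((λ x → proj₁ (Pᵢ (index x))) ,
      λ x → ≡.subst (λ y → P y (proj₁ (Pᵢ (index x)))) (element-index x) (proj₂ (Pᵢ (index x))))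

open FinSet using (Element; size; index; element)

-- The maximum in `val` ranges over the enumeration `function`; this lets it be compared with
-- arbitrary strategies.
function-surjective : ∀ X Y (f : Element X → Element Y) → ∃[ i ] ∀ x → function X Y i x ≡ f x
function-surjective X Y f = funToFin f′ , λ x → ≡.trans
  (≡.cong (element Y) (Fin.finToFun-funToFin f′ (index X x)))
  (≡.trans (element-index Y _) (≡.cong f (element-index X x)))
  where
  f′ : Fin (size X) → Fin (size Y)
  f′ = index Y ∘ f ∘ element X

-- Sums over finite sets and Kronecker deltas.

module FiniteSums {c ℓ₁ ℓ₂} (ℝ : RealNumbers c ℓ₁ ℓ₂) where
  open RealNumbers ℝ
  open OrderedField ℝ
  open IntegerCoefficients commutativeRing using (module Solver)
  open Solver
  open PosetReasoning ≤-poset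

  ∑-tabulate-single : ∀ {n} (g : Fin n → A) (f : A → Carrier) j →
                      (∀ i → ¬ i ≡ j → f (g i) ≈ 0#) → ∑ (tabulate g) f ≈ f (g j)
  ∑-tabulate-single {n = suc n} g f zero    off = trans
    (+-congˡ (∑-tabulate-zero (g ∘ suc) λ i → off (suc i) λ ())) (+-identityʳ _)
    where
    ∑-tabulate-zero : ∀ {n} (h : Fin n → _) → (∀ i → f (h i) ≈ 0#) → ∑ (tabulate h) f ≈ 0#
    ∑-tabulate-zero {zero}  h f≈0 = refl
    ∑-tabulate-zero {suc n} h f≈0 =
      trans (+-cong (f≈0 zero) (∑-tabulate-zero (h ∘ suc) (f≈0 ∘ suc))) (+-identityˡ 0#)
  ∑-tabulate-single {n = suc n} g f (suc j) off = trans
    (+-cong (off zero λ ()) (∑-tabulate-single (g ∘ suc) f j λ i i≢j → off (suc i) (i≢j ∘ Fin.suc-injective)))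
    (+-identityˡ _)

  δ : (X : FinSet) → Element X → Element X → Carrier
  δ X x y = 𝟙 (does (_≟ᶠ_ X x y))

  δ-refl : ∀ X x → δ X x x ≈ 1#
  δ-refl X x = reflexive (≡.cong 𝟙 (dec-true (_≟ᶠ_ X x x) ≡.refl))

  δ-sym : ∀ X x y → δ X x y ≈ δ X y x
  δ-sym X x y with _≟ᶠ_ X x y | _≟ᶠ_ X y x
  ... | yes _ | yes _ = refl
  ... | no  _ | no  _ = refl
  ... | yes p | no ¬q = contradiction (≡.sym p) ¬q
  ... | no ¬p | yes q = contradiction (≡.sym q) ¬p

  δ-nonneg : ∀ X x y → 0# ≤ δ X x y
  δ-nonneg X x y = 𝟙-nonneg (does (_≟ᶠ_ X x y))

  ∑-δ : ∀ X (f : Element X → Carrier) y → (∑[ x ∈ elements X ] δ X x y * f x) ≈ f y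
  ∑-δ X f y = trans
    (∑-tabulate-single (element X) (λ x → δ X x y * f x) (index X y) off)
    (trans (reflexive (≡.cong (λ z → δ X z y * f z) (element-index X y)))
      (trans (*-congʳ (δ-refl X y)) (*-identityˡ _)))
    where
    off : ∀ i → ¬ i ≡ index X y → δ X (element X i) y * f (element X i) ≈ 0#
    off i i≢ with _≟ᶠ_ X (element X i) y
    ... | yes eq = contradiction (≡.trans (≡.sym (index-element X i)) (≡.cong (index X) eq)) i≢
    ... | no  _  = zeroˡ _

  δ-× : ∀ X Y x y x′ y′ → δ (X ×ᶠ Y) (x , y) (x′ , y′) ≈ δ X x x′ * δ Y y y′
  δ-× X Y x y x′ y′ with _≟ᶠ_ (X ×ᶠ Y) (x , y) (x′ , y′) | _≟ᶠ_ X x x′ | _≟ᶠ_ Y y y′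
  ... | yes _      | yes _ | yes _ = sym (*-identityˡ 1#)
  ... | yes ≡.refl | no ¬p | _     = contradiction ≡.refl ¬p
  ... | yes ≡.refl | yes _ | no ¬q = contradiction ≡.refl ¬q
  ... | no ¬r | yes ≡.refl | yes ≡.refl = contradiction ≡.refl ¬r
  ... | no  _ | no  _      | _     = sym (zeroˡ _)
  ... | no  _ | yes _      | no  _ = sym (zeroʳ _)

  -- The enumeration of the product is never unfolded: each term is expanded against deltas and the
  -- sums are exchanged.
  ∑-× : ∀ X Y (f : Element (X ×ᶠ Y) → Carrier) →
        ∑ (elements (X ×ᶠ Y)) f ≈ (∑[ x ∈ elements X ] ∑[ y ∈ elements Y ] f (x , y))
  ∑-× X Y f = trans (∑-cong (elements (X ×ᶠ Y)) expand)
    (trans (∑-swap (elements (X ×ᶠ Y)) (elements X) _) (∑-cong (elements X) λ x →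
      trans (∑-swap (elements (X ×ᶠ Y)) (elements Y) _) (∑-cong (elements Y) λ y →
        ∑-δ (X ×ᶠ Y) f (x , y))))
    where
    expand : ∀ z → f z ≈ (∑[ x ∈ elements X ] ∑[ y ∈ elements Y ] δ (X ×ᶠ Y) z (x , y) * f z)
    expand z@(x′ , y′) = sym (trans
      (∑-cong (elements X) λ x → trans
        (∑-cong (elements Y) λ y → trans
          (*-congʳ (trans (δ-sym (X ×ᶠ Y) z (x , y)) (trans (δ-× X Y x y x′ y′) (*-comm _ _))))
          (*-assoc _ _ _))
        (∑-δ Y (λ _ → δ X x x′ * f z) y′))
      (∑-δ X (λ _ → f z) x′))

  ∑-unique : ∀ X (p : Element X → Bool) → (∀ x x′ → Bool.T (p x) → Bool.T (p x′) → x ≡ x′) →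
             (∑[ x ∈ elements X ] 𝟙 (p x)) ≤ 1#
  ∑-unique X p unique = ¬¬-excluded-middle {A = ∃ (Bool.T ∘ p)} >>= λ
    { (yes (x₀ , px₀)) → ≤-trans (∑-mono (elements X) (concentrated x₀ px₀)) (≤-reflexive (∑-δ X (λ _ → 1#) x₀))
    ; (no ¬∃p) → ≤-trans (∑-mono (elements X) {g = λ _ → 0#} λ x → empty x (λ px → ¬∃p (x , px)))
                   (≤-trans (≤-reflexive (∑-zero (elements X) (λ _ → refl))) 0≤1) }
    where
    empty : ∀ x → ¬ Bool.T (p x) → 𝟙 (p x) ≤ 0#
    empty x ¬px with p x
    ... | true  = ⊥-elim (¬px tt)
    ... | false = ≤-refl
    concentrated : ∀ x₀ → Bool.T (p x₀) → ∀ x → 𝟙 (p x) ≤ δ X x x₀ * 1#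
    concentrated x₀ px₀ x with p x in eq
    ... | false = *-nonneg (δ-nonneg X x x₀) 0≤1
    ... | true  = ≤-reflexive (trans (sym (δ-refl X x)) (trans
      (reflexive (≡.cong (δ X x) (unique x x₀ (≡.subst Bool.T (≡.sym eq) tt) px₀))) (sym (*-identityʳ _))))

-- The energy of fractional strategies and its convexity.

module Energy {c ℓ₁ ℓ₂} (ℝ : RealNumbers c ℓ₁ ℓ₂) where
  open RealNumbers ℝ
  open OrderedField ℝ
  open FiniteSums ℝ
  open IntegerCoefficients commutativeRing using (module Solver)
  open Solver
  open PosetReasoning ≤-poset
  open Games ℝ
  open Edge
  open Game

  module _ (G : Game) where
    es = edges G
    us = elements (U G)
    vs = elements (V G)
    as = elements (Σ G)

    fiber : Element (U G) → Edge (U G) (V G) (Σ G) → Carrier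
    fiber u e = δ (U G) u (source e) * weight e

    fiber-nonneg : ∀ u e → 0# ≤ fiber u e
    fiber-nonneg u e = *-nonneg (δ-nonneg (U G) u (source e)) (weight-nonneg e)

    Assignment : Set _
    Assignment = Element (V G) → Element (Σ G) → Carrier

    -- For unit point masses at the answers of a strategy this is the weight of the edges at `u`
    -- whose constraint accepts `α` with that answer. In general it is a linear functional of `h`.
    amp : Assignment → Element (U G) → Element (Σ G) → Carrier
    amp h u α = ∑[ e ∈ es ] fiber u e * (∑[ β ∈ as ] 𝟙 (accepts e α β) * h (target e) β)

    amp-cong : ∀ {h k} → (∀ v β → h v β ≈ k v β) → ∀ u α → amp h u α ≈ amp k u α
    amp-cong h≈k u α = ∑-cong es λ e → *-congˡ (∑-cong as λ β → *-congˡ (h≈k _ β))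

    amp-+ : ∀ h k u α → amp (λ v β → h v β + k v β) u α ≈ amp h u α + amp k u α
    amp-+ h k u α = trans
      (∑-cong es λ e → trans (*-congˡ (trans (∑-cong as λ β → distribˡ _ _ _) (∑-+ as _ _))) (distribˡ _ _ _))
      (∑-+ es _ _)

    amp-* : ∀ x h u α → amp (λ v β → x * h v β) u α ≈ x * amp h u α
    amp-* x h u α = trans (∑-cong es λ e → trans
        (*-congˡ (trans (∑-cong as λ β → solve 3 (λ a b c → a :* (b :* c) := b :* (a :* c)) refl _ _ _) (∑-*ˡ as x _)))
        (solve 3 (λ a b c → a :* (b :* c) := b :* (a :* c)) refl _ _ _))
      (∑-*ˡ es x _)

    amp-0 : ∀ u α → amp (λ _ _ → 0#) u α ≈ 0#
    amp-0 u α = ∑-zero es λ e → trans (*-congˡ (∑-zero as λ β → zeroʳ _)) (zeroʳ _)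

    amp-∑ : (xs : List A) (k : A → Assignment) → ∀ u α →
            amp (λ v β → ∑[ x ∈ xs ] k x v β) u α ≈ (∑[ x ∈ xs ] amp (k x) u α)
    amp-∑ []       k u α = amp-0 u α
    amp-∑ (x ∷ xs) k u α = trans (amp-+ (k x) _ u α) (+-congˡ (amp-∑ xs k u α))

    -- The collision weight, extended to a quadratic form on fractional, unnormalised strategies.
    energy : (Element (U G) → Carrier) → Assignment → Carrier
    energy ι h = ∑[ u ∈ us ] ∑[ α ∈ as ] ι u * (amp h u α * amp h u α)

    energy-cong : ∀ ι {h k} → (∀ v β → h v β ≈ k v β) → energy ι h ≈ energy ι k
    energy-cong ι h≈k = ∑-cong us λ u → ∑-cong as λ α →
      *-congˡ (*-cong (amp-cong h≈k u α) (amp-cong h≈k u α))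

    total : Assignment → Element (V G) → Carrier
    total h v = ∑ as (h v)

    point : (Element (V G) → Element (Σ G)) → (Element (V G) → Carrier) → Assignment
    point b m v β = δ (Σ G) β (b v) * m v

    -- The energy is convex in every row of an assignment, so replacing the row by
    -- a suitable vertex of the simplex of rows with the same total does not decrease it.
    module _ (ι : Element (U G) → Carrier) (0≤ι : ∀ u → 0# ≤ ι u) where

      replaceRow : Assignment → Element (V G) → Element (Σ G) → Assignment
      replaceRow h v₀ β₀ v β = if does (_≟ᶠ_ (V G) v v₀) then δ (Σ G) β β₀ * total h v₀ else h v β

      module _ (h : Assignment) (0≤h : ∀ v β → 0# ≤ h v β) (v₀ : Element (V G)) where

        step : Element (Σ G) → Assignment
        step β₀ v β = replaceRow h v₀ β₀ v β - h v β

        -- A row is the average of the vertices of its simplex, each vertex weighted by the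
        -- corresponding entry of the row.
        steps-balance : ∀ v β → (∑[ β₀ ∈ as ] h v₀ β₀ * step β₀ v β) ≈ 0#
        steps-balance v β with _≟ᶠ_ (V G) v v₀
        ... | no  _      = ∑-zero as λ β₀ → trans (*-congˡ (-‿inverseʳ _)) (zeroʳ _)
        ... | yes ≡.refl = trans
          (∑-cong as λ β₀ → trans
            (distribˡ _ _ _)
            (+-cong (trans (*-congˡ (*-congʳ (δ-sym (Σ G) β β₀)))
                      (solve 3 (λ a b c → a :* (b :* c) := b :* (a :* c)) refl _ _ _)) refl))
          (trans (∑-+ as _ _) (trans
            (+-cong (∑-δ (Σ G) (λ β₀ → h v β₀ * total h v) β) (∑-*ʳ as (- h v β) (h v)))
            (solve 2 (λ x t → x :* t :+ t :* (:- x) := con (+ 0)) refl _ _)))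

        amp-steps : ∀ u α → (∑[ β₀ ∈ as ] h v₀ β₀ * amp (step β₀) u α) ≈ 0#
        amp-steps u α = trans (∑-cong as λ β₀ → sym (amp-* _ (step β₀) u α))
          (trans (sym (amp-∑ as (λ β₀ v β → h v₀ β₀ * step β₀ v β) u α))
            (trans (amp-cong steps-balance u α) (amp-0 u α)))

        energy-step : ∀ β₀ → energy ι (replaceRow h v₀ β₀) - energy ι h ≈
          (∑[ u ∈ us ] ∑[ α ∈ as ] ι u * (amp (step β₀) u α * amp (step β₀) u α)
                                   + 2# * ι u * amp h u α * amp (step β₀) u α)
        energy-step β₀ = trans (+-congˡ (sym (∑-neg us _))) (trans (sym (∑-+ us _ _))
          (∑-cong us λ u → trans (+-congˡ (sym (∑-neg as _))) (trans (sym (∑-+ as _ _))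
            (∑-cong as λ α → trans (+-congʳ (*-congˡ (*-cong (shift u α) (shift u α))))
              (solve 3 (λ i y d → i :* ((y :+ d) :* (y :+ d)) :- i :* (y :* y)
                          := i :* (d :* d) :+ con (+ 2) :* i :* y :* d) refl (ι u) (amp h u α) _)))))
          where
          shift : ∀ u α → amp (replaceRow h v₀ β₀) u α ≈ amp h u α + amp (step β₀) u α
          shift u α = trans (amp-cong (λ v β → solve 2 (λ x y → x := y :+ (x :- y)) refl _ (h v β)) u α)
            (amp-+ h (step β₀) u α)

        -- In the second-order expansion `energy-step` the linear terms average to zero by
        -- `amp-steps`, which leaves squares with nonnegative coefficients.
        average-gain : 0# ≤ (∑[ β₀ ∈ as ] h v₀ β₀ * (energy ι (replaceRow h v₀ β₀) - energy ι h))
        average-gain = ≤-trans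
          (∑-nonneg us λ u → ∑-nonneg as λ α → ∑-nonneg as λ β₀ →
            *-nonneg (0≤h v₀ β₀) (*-nonneg (0≤ι u) (square-nonneg (amp (step β₀) u α))))
          (≤-reflexive (sym (trans
            (∑-cong as λ β₀ → trans (*-congˡ (energy-step β₀)) (trans (sym (∑-*ˡ us _ _)) (∑-cong us λ u → sym (∑-*ˡ as _ _))))
            (trans (∑-swap as us _) (∑-cong us λ u → trans (∑-swap as as _) (∑-cong as λ α → trans
              (∑-cong as λ β₀ → solve 4 (λ x i y d → x :* (i :* (d :* d) :+ con (+ 2) :* i :* y :* d)
                  := x :* (i :* (d :* d)) :+ con (+ 2) :* i :* y :* (x :* d)) refl _ (ι u) (amp h u α) _)
              (trans (∑-+ as _ _) (trans (+-congˡ (trans (∑-*ˡ as _ _) (trans (*-congˡ (amp-steps u α)) (zeroʳ _))))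
                (+-identityʳ _)))))))))

        -- If every replacement lost energy, the nonnegative average gain would force all weights
        -- `h v₀ β₀` to vanish. The row would then be zero, and replacing it by way of `β₁` would
        -- change nothing.
        best-row : Element (Σ G) → ¬ ¬ (∃[ β₀ ] energy ι h ≤ energy ι (replaceRow h v₀ β₀))
        best-row β₁ ¬best = ¬best (β₁ , ≤-reflexive (energy-cong ι unchanged))
          where
          decreases : ∀ β₀ → energy ι (replaceRow h v₀ β₀) ≤ energy ι h
          decreases β₀ E< = ¬best (β₀ , <⇒≤ E<)
          gain : Element (Σ G) → Carrier
          gain β₀ = energy ι (replaceRow h v₀ β₀) - energy ι h
          gain≤0 : ∀ β₀ → h v₀ β₀ * gain β₀ ≤ 0#
          gain≤0 β₀ = ≤-trans (*-monoʳ-≤ (0≤h v₀ β₀) (≤-trans (+-monoˡ-≤ _ (decreases β₀)) (≤-reflexive (-‿inverseʳ _))))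
            (≤-reflexive (zeroʳ _))
          tight : ∀ β₀ → 0# ≤ h v₀ β₀ * gain β₀ → h v₀ β₀ ≤ 0#
          tight β₀ 0≤hE 0<h = ¬best (β₀ , gap-nonneg⁻¹ (*-cancelˡ-≤ 0<h (≤-trans (≤-reflexive (zeroʳ _)) 0≤hE)))
          total≤0 : total h v₀ ≤ 0#
          total≤0 = ∑-slack as _ (h v₀) gain≤0 tight average-gain
          unchanged : ∀ v β → h v β ≈ replaceRow h v₀ β₁ v β
          unchanged v β with _≟ᶠ_ (V G) v v₀
          ... | no  _      = refl
          ... | yes ≡.refl = trans
            (≤-antisym (≤-trans (term≤∑ (0≤h v) (∈-elements (Σ G) β)) total≤0) (0≤h v β))
            (sym (trans (*-congˡ (≤-antisym total≤0 (∑-nonneg as (0≤h v)))) (zeroʳ _)))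

      open DecMembership (_≟ᶠ_ (V G)) using (_∈?_)

      module _ (h : Assignment) (0≤h : ∀ v β → 0# ≤ h v β) (β₁ : Element (Σ G)) where

        mix : List (Element (V G)) → (Element (V G) → Element (Σ G)) → Assignment
        mix ws b v β = if does (v ∈? ws) then point b (total h) v β else h v β

        mix-nonneg : ∀ ws b v β → 0# ≤ mix ws b v β
        mix-nonneg ws b v β with does (v ∈? ws)
        ... | true  = *-nonneg (δ-nonneg (Σ G) β (b v)) (∑-nonneg as (0≤h v))
        ... | false = 0≤h v β

        mix-total : ∀ ws b v → total (mix ws b) v ≈ total h v
        mix-total ws b v with does (v ∈? ws)
        ... | true  = ∑-δ (Σ G) (λ _ → total h v) (b v)
        ... | false = refl

        mix-∷ : ∀ w ws b β₀ v β → replaceRow (mix ws b) w β₀ v β ≈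
                mix (w ∷ ws) (λ v → if does (_≟ᶠ_ (V G) v w) then β₀ else b v) v β
        mix-∷ w ws b β₀ v β with _≟ᶠ_ (V G) v w
        ... | yes ≡.refl = *-congˡ (mix-total ws b v)
        ... | no  _ with does (v ∈? ws)
        ...   | true  = refl
        ...   | false = refl

        -- Rows are concentrated one at a time. Each keeps its total, so the resulting point masses
        -- carry the totals of the original `h`.
        concentrate-on : ∀ ws → ¬ ¬ (∃[ b ] energy ι h ≤ energy ι (mix ws b))
        concentrate-on []       = return ((λ _ → β₁) , ≤-refl)
        concentrate-on (w ∷ ws) = concentrate-on ws >>= λ { (b , E≤) →
          best-row (mix ws b) (mix-nonneg ws b) w β₁ >>= λ { (β₀ , E≤′) →
          return (_ , ≤-trans E≤ (≤-trans E≤′ (≤-reflexive (energy-cong ι (mix-∷ w ws b β₀))))) } }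

        concentrate : ¬ ¬ (∃[ b ] energy ι h ≤ energy ι (point b (total h)))
        concentrate = concentrate-on vs >>= λ { (b , E≤) →
          return (b , ≤-trans E≤ (≤-reflexive (energy-cong ι (mix-all b)))) }
          where
          mix-all : ∀ b v β → mix vs b v β ≈ point b (total h) v β
          mix-all b v β with v ∈? vs
          ... | yes _   = refl
          ... | no  v∉  = contradiction (∈-elements (V G) v) v∉

-- Collision weight compared with winning probability and value.

module Collision {c ℓ₁ ℓ₂} (ℝ : RealNumbers c ℓ₁ ℓ₂) where
  open RealNumbers ℝ
  open OrderedField ℝ
  open FiniteSums ℝ
  open Energy ℝ
  open IntegerCoefficients commutativeRing using (module Solver)
  open Solver
  open PosetReasoning ≤-poset
  open Games ℝ
  open Edge
  open Game

  module _ (G : Game) where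

    W : Carrier
    W = totalWeight (edges G)

    vertexWeight : Element (U G) → Carrier
    vertexWeight u = ∑ (es G) (fiber G u)

    vertexWeight-nonneg : ∀ u → 0# ≤ vertexWeight u
    vertexWeight-nonneg u = ∑-nonneg (es G) (fiber-nonneg G u)

    ∑-vertexWeight : ∑ (us G) vertexWeight ≈ W
    ∑-vertexWeight = trans (∑-swap (us G) (es G) _)
      (∑-cong (es G) λ e → ∑-δ (U G) (λ _ → weight e) (source e))

    hits : (Element (V G) → Element (Σ G)) → Element (U G) → Element (Σ G) → Carrier
    hits g u α = ∑[ e ∈ es G ] fiber G u e * 𝟙 (accepts e α (g (target e)))

    collision : (Element (U G) → Carrier) → (Element (V G) → Element (Σ G)) → Carrier
    collision ι g = ∑[ u ∈ us G ] ∑[ α ∈ as G ] ι u * (hits g u α * hits g u α)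

    win : (Element (U G) → Element (Σ G)) → (Element (V G) → Element (Σ G)) → Carrier
    win f g = ∑ (es G) (acceptedWeight f g)

    hits-nonneg : ∀ g u α → 0# ≤ hits g u α
    hits-nonneg g u α = ∑-nonneg (es G) λ e → *-nonneg (fiber-nonneg G u e) (𝟙-nonneg _)

    hits≤vertexWeight : ∀ g u α → hits g u α ≤ vertexWeight u
    hits≤vertexWeight g u α = ∑-mono (es G) λ e →
      ≤-trans (*-monoʳ-≤ (fiber-nonneg G u e) (𝟙≤1 _)) (≤-reflexive (*-identityʳ _))

    win-hits : ∀ f g → win f g ≈ (∑[ u ∈ us G ] hits g u (f u))
    win-hits f g = sym (trans (∑-swap (us G) (es G) _) (∑-cong (es G) λ e → trans
        (∑-cong (us G) λ u → *-assoc _ _ _)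
        (trans (∑-δ (U G) (λ u → weight e * 𝟙 (accepts e (f u) (g (target e)))) (source e)) (gate e))))
      where
      gate : ∀ e → weight e * 𝟙 (accepts e (f (source e)) (g (target e))) ≈ acceptedWeight f g e
      gate e with accepts e (f (source e)) (g (target e))
      ... | true  = *-identityʳ _
      ... | false = zeroʳ _

    win-cong : ∀ {f f′ g g′} → (∀ u → f u ≡ f′ u) → (∀ v → g v ≡ g′ v) → win f g ≈ win f′ g′
    win-cong f≡ g≡ = ∑-cong (es G) λ e → reflexive
      (≡.cong₂ (λ α β → if accepts e α β then weight e else 0#) (f≡ (source e)) (g≡ (target e)))

    val-upper : ∀ {ρ} → val G ≤ ρ → ∀ f g → win f g ≤ ρ * W
    val-upper {ρ} val≤ρ f g with function-surjective (U G) (Σ G) f | function-surjective (V G) (Σ G) g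
    ... | i , fᵢ≡f | j , gⱼ≡g = begin
      win f g                                     ≈⟨ win-cong fᵢ≡f gⱼ≡g ⟨
      win fᵢ gⱼ                                   ≈⟨ *-identityʳ _ ⟨
      win fᵢ gⱼ * 1#                              ≈⟨ *-congˡ (*-recip W (total-pos G)) ⟨
      win fᵢ gⱼ * (W * recip W (total-pos G))     ≈⟨ solve 3 (λ x w r → x :* (w :* r) := x :* r :* w) refl _ _ _ ⟩
      winProb G fᵢ gⱼ * W                         ≤⟨ *-monoˡ-≤ (<⇒≤ (total-pos G)) prob≤ρ ⟩
      ρ * W                                       ∎
      where
      fᵢ = function (U G) (Σ G) i
      gⱼ = function (V G) (Σ G) j
      prob≤ρ : winProb G fᵢ gⱼ ≤ ρ
      prob≤ρ = ≤-trans (max₀-upper (λ j → winProb G fᵢ (function (V G) (Σ G) j)) j)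
        (≤-trans (max₀-upper (λ i → max₀ λ j → winProb G (function (U G) (Σ G) i) (function (V G) (Σ G) j)) i) val≤ρ)

    val-least : ∀ {x} → 0# ≤ x → (∀ f g → win f g ≤ x * W) → val G ≤ x
    val-least {x} 0≤x win≤ =
      max₀-least (λ i → max₀ λ j → winProb G (fᵢ i) (gⱼ j)) 0≤x λ i →
      max₀-least (λ j → winProb G (fᵢ i) (gⱼ j)) 0≤x λ j →
      *-cancelʳ-≤ (total-pos G) (≤-trans (≤-reflexive (cancel (win (fᵢ i) (gⱼ j)))) (win≤ (fᵢ i) (gⱼ j)))
      where
      fᵢ = function (U G) (Σ G)
      gⱼ = function (V G) (Σ G)
      cancel : ∀ y → y / W [ total-pos G ] * W ≈ y
      cancel y = trans (solve 3 (λ x w r → x :* r :* w := x :* (w :* r)) refl y W (recip W (total-pos G)))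
        (trans (*-congˡ (*-recip W (total-pos G))) (*-identityʳ y))

    module _ {ι : Element (U G) → Carrier} (inv : ∀ u → GeneralisedInverse (vertexWeight u) (ι u)) where

      -- Cauchy–Schwarz, from 0 ≤ ∑ᵤ ι(u) (W x(u) − X w(u))².
      win²≤collision : ∀ f g → win f g * win f g ≤ W * collision ι g
      win²≤collision f g = ≤-trans (gap-nonneg⁻¹ (*-cancelˡ-≤ (total-pos G)
        (≤-trans (≤-reflexive (zeroʳ W)) (≤-trans 0≤variance (≤-reflexive variance)))))
        (*-monoʳ-≤ (<⇒≤ (total-pos G)) S≤collision)
        where
        X = win f g
        x : Element (U G) → Carrier
        x u = hits g u (f u)
        S = ∑[ u ∈ us G ] ι u * (x u * x u)
        S≤collision : S ≤ collision ι g
        S≤collision = ∑-mono (us G) λ u → term≤∑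
          (λ α → *-nonneg (proj₁ (inv u)) (square-nonneg (hits g u α))) (∈-elements (Σ G) (f u))
        d : Element (U G) → Carrier
        d u = W * x u - (X * vertexWeight u)
        0≤variance : 0# ≤ (∑[ u ∈ us G ] ι u * (d u * d u))
        0≤variance = ∑-nonneg (us G) λ u → *-nonneg (proj₁ (inv u)) (square-nonneg (d u))
        variance : (∑[ u ∈ us G ] ι u * (d u * d u)) ≈ W * (W * S - (X * X))
        variance = trans (∑-cong (us G) λ u → trans
            (solve 5 (λ i t x y w → i :* ((t :* x :- y :* w) :* (t :* x :- y :* w)) :=
                t :* t :* (i :* (x :* x)) :+ :- (con (+ 2) :* t :* y) :* (i :* (w :* x)) :+ y :* y :* (i :* (w :* w)))
              refl (ι u) W (x u) X (vertexWeight u))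
            (+-cong (+-congˡ (*-congˡ (absorb (inv u) (hits-nonneg g u (f u)) (hits≤vertexWeight g u (f u)))))
              (*-congˡ (proj₂ (inv u)))))
          (trans (∑-+ (us G) _ _) (trans
            (+-cong (trans (∑-+ (us G) _ _) (+-cong (∑-*ˡ (us G) _ _)
                (trans (∑-*ˡ (us G) _ _) (*-congˡ (sym (win-hits f g))))))
              (trans (∑-*ˡ (us G) _ _) (*-congˡ ∑-vertexWeight)))
            (solve 3 (λ t s y → t :* t :* s :+ :- (con (+ 2) :* t :* y) :* y :+ y :* y :* t
                := t :* (t :* s :- y :* y)) refl W S X)))

      module _ (projection : IsProjection G) where

        -- By the projection property an edge accepts at most one `α` together with the answer of
        -- `g`, so it is counted at most once.
        ∑-hits : ∀ g u → ∑ (as G) (hits g u) ≤ vertexWeight u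
        ∑-hits g u = ≤-trans
          (≤-reflexive (trans (∑-swap (as G) (es G) _) (∑-cong (es G) λ e → ∑-*ˡ (as G) _ _)))
          (∑-mono-∈ (es G) λ e e∈es → ≤-trans
            (*-monoʳ-≤ (fiber-nonneg G u e) (∑-unique (Σ G) _ λ α α′ → All.lookup projection e∈es _ α α′))
            (≤-reflexive (*-identityʳ _)))

        -- Let `f u` be an answer with the most hits at `u`. The sum of the squared hits is at most
        -- their maximum times their sum, hence at most the maximum times the weight of `u`, which
        -- `ι u` absorbs.
        collision≤win : Element (Σ G) → ∀ g → ¬ ¬ (∃[ f ] collision ι g ≤ win f g)
        collision≤win α₀ g = ¬¬-choice (U G) (λ u → argmax (hits g u) α₀ (as G)) >>= λ { (f , f-max) →
          return (f , ≤-trans (∑-mono (us G) λ u → begin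
            (∑[ α ∈ as G ] ι u * (hits g u α * hits g u α))
              ≤⟨ ∑-mono (as G) (λ α → *-monoʳ-≤ (proj₁ (inv u)) (*-monoˡ-≤ (hits-nonneg g u α)
                   (proj₂ (f-max u) α (∈-elements (Σ G) α)))) ⟩
            (∑[ α ∈ as G ] ι u * (hits g u (f u) * hits g u α))
              ≈⟨ trans (∑-*ˡ (as G) _ _) (*-congˡ (∑-*ˡ (as G) _ _)) ⟩
            ι u * (hits g u (f u) * ∑ (as G) (hits g u))
              ≤⟨ *-monoʳ-≤ (proj₁ (inv u)) (*-monoʳ-≤ (hits-nonneg g u (f u)) (∑-hits g u)) ⟩
            ι u * (hits g u (f u) * vertexWeight u)
              ≈⟨ *-congˡ (*-comm _ _) ⟩
            ι u * (vertexWeight u * hits g u (f u))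
              ≈⟨ absorb (inv u) (hits-nonneg g u (f u)) (hits≤vertexWeight g u (f u)) ⟩
            hits g u (f u) ∎) (≤-reflexive (sym (win-hits f g)))) }

        collision≤val : ∀ {ρ} → val G ≤ ρ → Element (Σ G) → ∀ g → collision ι g ≤ ρ * W
        collision≤val val≤ρ α₀ g = collision≤win α₀ g >>= λ { (f , collision≤) →
          ≤-trans collision≤ (val-upper val≤ρ f g) }

-- Energies as sums over pairs of edges, and their bound for a projection game.

module VectorValue {c ℓ₁ ℓ₂} (ℝ : RealNumbers c ℓ₁ ℓ₂) where
  open RealNumbers ℝ
  open OrderedField ℝ
  open CorrelatedSampling ℝ
  open FiniteSums ℝ
  open Energy ℝ
  open Collision ℝ
  open IntegerCoefficients commutativeRing using (module Solver)
  open Solver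
  open PosetReasoning ≤-poset
  open Games ℝ
  open Edge
  open Game

  -- The gap is the square of `x - σ * y` if `x * x` is the smaller square, and of `y - σ * x`
  -- otherwise.
  square-⊓⊔ : ∀ σ x y → 2# * σ * (x * y) ≤ (x * x ⊓ y * y) + σ * σ * (x * x ⊔ y * y)
  square-⊓⊔ σ x y = ≤-total (x * x) (y * y) >>= λ
    { (inj₁ x²≤y²) → ≤-by-gap _ (square-nonneg (x - (σ * y))) (trans
        (+-cong (+-congˡ (-‿cong (⊔≈ʳ x²≤y²))) (*-congˡ (⊔≈ʳ x²≤y²)))
        (solve 3 (λ s x y → x :* x :+ y :* y :- y :* y :+ s :* s :* (y :* y)
           := con (+ 2) :* s :* (x :* y) :+ (x :- s :* y) :* (x :- s :* y)) refl σ x y))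
    ; (inj₂ y²≤x²) → ≤-by-gap _ (square-nonneg (y - (σ * x))) (trans
        (+-cong (+-congˡ (-‿cong (⊔≈ˡ y²≤x²))) (*-congˡ (⊔≈ˡ y²≤x²)))
        (solve 3 (λ s x y → x :* x :+ y :* y :- x :* x :+ s :* s :* (x :* x)
           := con (+ 2) :* s :* (x :* y) :+ (y :- s :* x) :* (y :- s :* x)) refl σ x y)) }

  module _ (G : Game) (ι : Element (U G) → Carrier) where

    Pair : Set _
    Pair = Edge (U G) (V G) (Σ G) × Edge (U G) (V G) (Σ G)

    pairs : List Pair
    pairs = cartesianProduct (es G) (es G)

    -- Up to the total weight, the law of two edges drawn independently at a common random vertex
    -- `u`.
    pairWeight : Pair → Carrier
    pairWeight (e , e′) = ∑[ u ∈ us G ] ι u * (fiber G u e * fiber G u e′)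

    -- The number of answers `α` accepted by both edges; for a projection game it indicates whether
    -- `β` and `β′` force the same answer.
    agree : Pair → Element (Σ G) → Element (Σ G) → Carrier
    agree (e , e′) β β′ = ∑[ α ∈ as G ] 𝟙 (accepts e α β) * 𝟙 (accepts e′ α β′)

    -- Expanding the square introduces a second edge at `u`. The general `y` covers both `collision`
    -- and the energy of point masses.
    ∑-square : (y : Edge (U G) (V G) (Σ G) → Element (Σ G) → Carrier) →
      (∑[ u ∈ us G ] ∑[ α ∈ as G ] ι u * ((∑[ e ∈ es G ] fiber G u e * y e α) * (∑[ e ∈ es G ] fiber G u e * y e α)))
        ≈ (∑[ i ∈ pairs ] pairWeight i * (∑[ α ∈ as G ] y (proj₁ i) α * y (proj₂ i) α))
    ∑-square y = trans
      (∑-cong (us G) λ u → trans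
        (∑-cong (as G) λ α → trans (*-congˡ (trans (∑-* (es G) (es G) _ _) (sym (∑-cartesianProductWith _,_ (es G) (es G) _))))
          (sym (∑-*ˡ pairs _ _)))
        (trans (∑-swap (as G) pairs _) (∑-cong pairs λ i → trans
          (∑-cong (as G) λ α → solve 5 (λ k f a g b → k :* (f :* a :* (g :* b)) := k :* (f :* g) :* (a :* b)) refl _ _ _ _ _)
          (∑-*ˡ (as G) _ _))))
      (trans (∑-swap (us G) pairs _) (∑-cong pairs λ i → ∑-*ʳ (us G) _ _))

    collision-pairs : ∀ g → collision G ι g ≈
      (∑[ i ∈ pairs ] pairWeight i * agree i (g (target (proj₁ i))) (g (target (proj₂ i))))
    collision-pairs g = ∑-square λ e α → 𝟙 (accepts e α (g (target e)))

    energy-point : ∀ b m → energy G ι (point G b m) ≈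
      (∑[ i ∈ pairs ] pairWeight i * (agree i (b (target (proj₁ i))) (b (target (proj₂ i)))
                                       * (m (target (proj₁ i)) * m (target (proj₂ i)))))
    energy-point b m = trans
      (∑-cong (us G) λ u → ∑-cong (as G) λ α → *-congˡ (*-cong (amp-point u α) (amp-point u α)))
      (trans (∑-square λ e α → 𝟙 (accepts e α (b (target e))) * m (target e))
        (∑-cong pairs λ i → *-congˡ (trans
          (∑-cong (as G) λ α → solve 4 (λ a b c d → a :* b :* (c :* d) := a :* c :* (b :* d)) refl _ _ _ _)
          (∑-*ʳ (as G) _ _))))
      where
      amp-point : ∀ u α → amp G (point G b m) u α ≈
                  (∑[ e ∈ es G ] fiber G u e * (𝟙 (accepts e α (b (target e))) * m (target e)))
      amp-point u α = ∑-cong (es G) λ e → *-congˡ (trans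
        (∑-cong (as G) λ β → solve 3 (λ a b c → a :* (b :* c) := b :* (a :* c)) refl _ _ _)
        (∑-δ (Σ G) (λ β → 𝟙 (accepts e α β) * m (target e)) (b (target e))))

    agree-nonneg : ∀ i β β′ → 0# ≤ agree i β β′
    agree-nonneg i β β′ = ∑-nonneg (as G) λ α → *-nonneg (𝟙-nonneg _) (𝟙-nonneg _)

    agree≤1 : IsProjection G → ∀ i → i ∈ pairs → ∀ β β′ → agree i β β′ ≤ 1#
    agree≤1 projection i@(e , e′) i∈pairs β β′ = ≤-trans
      (∑-mono (as G) λ α → ≤-trans (*-monoʳ-≤ (𝟙-nonneg _) (𝟙≤1 _)) (≤-reflexive (*-identityʳ _)))
      (∑-unique (Σ G) (λ α → accepts e α β) λ α α′ →
        All.lookup projection (proj₁ (∈-cartesianProduct⁻ (es G) (es G) i∈pairs)) β α α′)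

    ∑-pairWeight : (∀ u → GeneralisedInverse (vertexWeight G u) (ι u)) → ∑ pairs pairWeight ≈ W G
    ∑-pairWeight inv = trans (∑-swap pairs (us G) _) (trans
      (∑-cong (us G) λ u → trans (∑-*ˡ pairs (ι u) _) (trans
        (*-congˡ (trans (∑-cartesianProductWith _,_ (es G) (es G) _) (sym (∑-* (es G) (es G) _ _))))
        (proj₂ (inv u))))
      (∑-vertexWeight G))

    pairWeight-nonneg : (∀ u → 0# ≤ ι u) → ∀ i → 0# ≤ pairWeight i
    pairWeight-nonneg 0≤ι (e , e′) = ∑-nonneg (us G) λ u →
      *-nonneg (0≤ι u) (*-nonneg (fiber-nonneg G u e) (fiber-nonneg G u e′))

  -- Energy bound for families of fractional strategies of bounded norm.

  module _ (G : Game) (projection : IsProjection G)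
           {ι : Element (U G) → Carrier} (inv : ∀ u → GeneralisedInverse (vertexWeight G u) (ι u))
           {ρ σ : Carrier} (0<σ : 0# < σ) (σσ≈ρ : σ * σ ≈ ρ) (0<ρ : 0# < ρ) (ρ≤1 : ρ ≤ 1#)
           (collision≤ : ∀ g → collision G ι g ≤ ρ * W G)
           (Ω : FinSet) {q : Element Ω → Carrier} (0≤q : ∀ ω → 0# ≤ q ω)
           {K : Carrier} (0≤K : 0# ≤ K)
           where

    0≤ι : ∀ u → 0# ≤ ι u
    0≤ι u = proj₁ (inv u)

    0≤ρ : 0# ≤ ρ
    0≤ρ = <⇒≤ 0<ρ

    0≤1+ρ : 0# ≤ 1# + ρ
    0≤1+ρ = <⇒≤ (0<1+ 0<ρ)

    ωs : List (Element Ω)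
    ωs = elements Ω

    module _ (b : Element Ω → Element (V G) → Element (Σ G))
             (m : Element Ω → Element (V G) → Carrier)
             (norm≤ : ∀ v → (∑[ ω ∈ ωs ] q ω * (m ω v * m ω v)) ≤ K)
             where

      μ : Element (V G) → Element Ω → Carrier
      μ v ω = m ω v * m ω v

      p : Pair G ι → Carrier
      p = pairWeight G ι

      0≤p : ∀ i → 0# ≤ p i
      0≤p = pairWeight-nonneg G ι 0≤ι

      accord : Pair G ι → Element Ω → Carrier
      accord i ω = agree G ι i (b ω (target (proj₁ i))) (b ω (target (proj₂ i)))

      smaller larger : Pair G ι → Element Ω → Carrier
      smaller i ω = μ (target (proj₁ i)) ω ⊓ μ (target (proj₂ i)) ω
      larger  i ω = μ (target (proj₁ i)) ω ⊔ μ (target (proj₂ i)) ω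

      smaller-nonneg : ∀ i ω → 0# ≤ smaller i ω
      smaller-nonneg i ω = ⊓-nonneg (square-nonneg (m ω _)) (square-nonneg (m ω _))

      larger-nonneg : ∀ i ω → 0# ≤ larger i ω
      larger-nonneg i ω = ⊔-nonneg (square-nonneg (m ω _))

      shared spread : Pair G ι → Carrier
      shared i = ∑[ ω ∈ ωs ] q ω * (accord i ω * smaller i ω)
      spread i = ∑[ ω ∈ ωs ] q ω * larger i ω

      shared-nonneg : ∀ i → 0# ≤ shared i
      shared-nonneg i = ∑-nonneg ωs λ ω → *-nonneg (0≤q ω) (*-nonneg (agree-nonneg G ι i _ _) (smaller-nonneg i ω))

      spread-nonneg : ∀ i → 0# ≤ spread i
      spread-nonneg i = ∑-nonneg ωs λ ω → *-nonneg (0≤q ω) (larger-nonneg i ω)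

      -- Bounding `accord` by 1 leaves the maxima plus the minima, which add up to the norms at the
      -- two end points, each at most `K`.
      spread+shared≤ : ∀ i → i ∈ pairs G ι → spread i + shared i ≤ 2# * K
      spread+shared≤ i@(e , e′) i∈ = begin
        spread i + shared i
          ≈⟨ ∑-+ ωs _ _ ⟨
        (∑[ ω ∈ ωs ] q ω * larger i ω + q ω * (accord i ω * smaller i ω))
          ≤⟨ ∑-mono ωs (λ ω → +-mono-≤ ≤-refl (*-monoʳ-≤ (0≤q ω) (≤-trans
               (*-monoˡ-≤ (smaller-nonneg i ω) (agree≤1 G ι projection i i∈ _ _)) (≤-reflexive (*-identityˡ _))))) ⟩
        (∑[ ω ∈ ωs ] q ω * larger i ω + q ω * smaller i ω)
          ≈⟨ ∑-cong ωs (λ ω → solve 4 (λ q x y l → q :* l :+ q :* (x :+ y :- l) := q :* x :+ q :* y) refl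
               (q ω) (μ (target e) ω) (μ (target e′) ω) (larger i ω)) ⟩
        (∑[ ω ∈ ωs ] q ω * μ (target e) ω + q ω * μ (target e′) ω)
          ≈⟨ ∑-+ ωs _ _ ⟩
        (∑[ ω ∈ ωs ] q ω * μ (target e) ω) + (∑[ ω ∈ ωs ] q ω * μ (target e′) ω)
          ≤⟨ +-mono-≤ (norm≤ _) (norm≤ _) ⟩
        K + K
          ≈⟨ solve 1 (λ k → k :+ k := con (+ 2) :* k) refl K ⟩
        2# * K ∎

      shared≤spread : ∀ i → i ∈ pairs G ι → shared i ≤ spread i
      shared≤spread i i∈ = ∑-mono ωs λ ω → *-monoʳ-≤ (0≤q ω) (≤-trans
        (*-monoˡ-≤ (smaller-nonneg i ω) (agree≤1 G ι projection i i∈ _ _))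
        (≤-trans (≤-reflexive (*-identityˡ _)) (≤-trans (⊓≤ˡ _ _) (x≤x⊔y _ _))))

      -- The tangent of x ↦ x / (2K − x) at x = 2ρK / (1 + ρ), scaled by 2K.
      tangent : Carrier → Carrier
      tangent x = (1# + ρ) * (1# + ρ) * x - (2# * (ρ * ρ) * K)

      -- A convex function lies above its tangent: with `y` raised to `2K - x` the gap is the square
      -- of `(1 + ρ) x - 2ρK`. The point of tangency is where `x / (2K - x)` equals `ρ`. A negative
      -- tangent leaves nothing to show.
      tangent-below : ∀ x y → 0# ≤ x → 0# ≤ y → y + x ≤ 2# * K → tangent x * y ≤ 2# * K * x
      tangent-below x y 0≤x 0≤y y+x≤ = ≤-total 0# (tangent x) >>= λ
        { (inj₁ 0≤t) → ≤-trans (*-monoʳ-≤ 0≤t y≤)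
            (≤-by-gap _ (square-nonneg ((1# + ρ) * x - (2# * ρ * K)))
              (solve 3 (λ r k x → con (+ 2) :* k :* x :=
                ((con (+ 1) :+ r) :* (con (+ 1) :+ r) :* x :- con (+ 2) :* (r :* r) :* k) :* (con (+ 2) :* k :- x)
                :+ ((con (+ 1) :+ r) :* x :- con (+ 2) :* r :* k) :* ((con (+ 1) :+ r) :* x :- con (+ 2) :* r :* k))
                refl ρ K x))
        ; (inj₂ t≤0) → ≤-trans (≤-trans (*-monoˡ-≤ 0≤y t≤0) (≤-reflexive (zeroˡ y)))
            (*-nonneg (*-nonneg (<⇒≤ 0<2) 0≤K) 0≤x) }
        where
        y≤ : y ≤ 2# * K - x
        y≤ = ≤-trans (≤-reflexive (solve 2 (λ x y → y := y :+ x :- x) refl x y)) (+-monoˡ-≤ (- x) y+x≤)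

      -- The factor `2# * K` matches the scaling of `tangent` and avoids a division by `K`, which
      -- may be zero.
      value : Pair G ι → Element (Σ G) → Element (Σ G) → Carrier
      value i β β′ = 2# * K * p i * agree G ι i β β′

      R : Pair G ι → Carrier
      R i = p i * tangent (shared i)

      0≤2K : 0# ≤ 2# * K
      0≤2K = *-nonneg (<⇒≤ 0<2) 0≤K

      module Sampling (g₀ : Element (V G) → Element (Σ G)) = Rounding
        (_≟ᶠ_ (V G)) (elements (V G)) (∈-elements (V G)) g₀
        (target ∘ proj₁) (target ∘ proj₂)
        value (λ i β β′ → *-nonneg (*-nonneg 0≤2K (0≤p i)) (agree-nonneg G ι i β β′))
        ωs q 0≤q μ (λ v ω → square-nonneg (m ω v)) (λ v ω → b ω v) R

      module _ (g₀ : Element (V G) → Element (Σ G)) where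
        open Sampling g₀

        -- The first clause is `tangent-below` at `shared i` and `spread i`. For the second, a
        -- vanishing `union i` forces `shared i` to vanish, and `tangent` is nonpositive at 0.
        affordable : ∀ {i} → i ∈ pairs G ι → Affordable i
        affordable {i} i∈ = R-union , R-null
          where
          R-union : R i * union i ≤ common i
          R-union = begin
            p i * tangent (shared i) * union i
              ≈⟨ *-assoc _ _ _ ⟩
            p i * (tangent (shared i) * union i)
              ≤⟨ *-monoʳ-≤ (0≤p i) (tangent-below (shared i) (union i) (shared-nonneg i) (spread-nonneg i) (spread+shared≤ i i∈)) ⟩
            p i * (2# * K * shared i)
              ≈⟨ solve 3 (λ p k x → p :* (k :* x) := k :* p :* x) refl (p i) (2# * K) (shared i) ⟩
            2# * K * p i * shared i
              ≈⟨ ∑-*ˡ ωs _ _ ⟨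
            (∑[ ω ∈ ωs ] 2# * K * p i * (q ω * (accord i ω * smaller i ω)))
              ≈⟨ ∑-cong ωs (λ ω → solve 4 (λ k q c s → k :* (q :* (c :* s)) := q :* (k :* c :* s)) refl _ (q ω) (accord i ω) (smaller i ω)) ⟩
            common i ∎
          R-null : union i ≤ 0# → R i ≤ 0#
          R-null union≤0 = ≤-trans (*-monoʳ-≤ (0≤p i) (≤-by-gap (2# * (ρ * ρ) * K)
              (*-nonneg (*-nonneg (<⇒≤ 0<2) (*-nonneg 0≤ρ 0≤ρ)) 0≤K)
              (sym (trans (+-congʳ (+-congʳ (*-congˡ shared≈0)))
                (solve 2 (λ r k → (con (+ 1) :+ r) :* (con (+ 1) :+ r) :* con (+ 0) :- con (+ 2) :* (r :* r) :* k
                  :+ con (+ 2) :* (r :* r) :* k := con (+ 0)) refl ρ K)))))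
            (≤-reflexive (zeroʳ _))
            where
            shared≈0 : shared i ≈ 0#
            shared≈0 = ≤-antisym (≤-trans (shared≤spread i i∈) union≤0) (shared-nonneg i)

        commonality : Carrier
        commonality = ∑[ i ∈ pairs G ι ] p i * shared i

        -- Rounding yields one strategy `g` whose collision weight times `2K` is at least the sum of
        -- the promises `R`. As `tangent` is affine, that sum is an affine function of
        -- `commonality`, while the collision weight is at most `ρ * W G`.
        commonality≤ : (1# + ρ) * commonality ≤ 2# * ρ * (K * W G)
        commonality≤ = round (length (pairs G ι)) (pairs G ι) ℕ.≤-refl (All.tabulate affordable) >>= λ { (g , ∑R≤) →
          *-cancelˡ-≤ (0<1+ 0<ρ) (begin
            (1# + ρ) * ((1# + ρ) * E)
              ≈⟨ solve 4 (λ r e k w → (con (+ 1) :+ r) :* ((con (+ 1) :+ r) :* e) :=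
                   (con (+ 1) :+ r) :* (con (+ 1) :+ r) :* e :+ (:- (con (+ 2) :* (r :* r) :* k)) :* w
                   :+ con (+ 2) :* (r :* r) :* (k :* w)) refl ρ E K (W G) ⟩
            (1# + ρ) * (1# + ρ) * E + - (2# * (ρ * ρ) * K) * W G + 2# * (ρ * ρ) * (K * W G)
              ≈⟨ +-congʳ ∑R ⟨
            ∑ (pairs G ι) R + 2# * (ρ * ρ) * (K * W G)
              ≤⟨ +-monoˡ-≤ _ ∑R≤ ⟩
            (∑[ i ∈ pairs G ι ] value i (g (target (proj₁ i))) (g (target (proj₂ i)))) + 2# * (ρ * ρ) * (K * W G)
              ≈⟨ +-congʳ (trans (∑-cong (pairs G ι) λ i → *-assoc (2# * K) (p i) _)
                   (trans (∑-*ˡ (pairs G ι) (2# * K) _) (*-congˡ (sym (collision-pairs G ι g))))) ⟩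
            2# * K * collision G ι g + 2# * (ρ * ρ) * (K * W G)
              ≤⟨ +-monoˡ-≤ _ (*-monoʳ-≤ 0≤2K (collision≤ g)) ⟩
            2# * K * (ρ * W G) + 2# * (ρ * ρ) * (K * W G)
              ≈⟨ solve 3 (λ r k w → con (+ 2) :* k :* (r :* w) :+ con (+ 2) :* (r :* r) :* (k :* w)
                   := (con (+ 1) :+ r) :* (con (+ 2) :* r :* (k :* w))) refl ρ K (W G) ⟩
            (1# + ρ) * (2# * ρ * (K * W G)) ∎) }
          where
          E = commonality
          ∑R : ∑ (pairs G ι) R ≈ (1# + ρ) * (1# + ρ) * E + - (2# * (ρ * ρ) * K) * W G
          ∑R = trans (∑-cong (pairs G ι) λ i →
              solve 4 (λ p t x k → p :* (t :* x :- k) := t :* (p :* x) :+ (:- k) :* p) refl (p i) ((1# + ρ) * (1# + ρ)) (shared i) (2# * (ρ * ρ) * K))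
            (trans (∑-+ (pairs G ι) _ _) (+-cong (∑-*ˡ (pairs G ι) _ _)
              (trans (∑-*ˡ (pairs G ι) _ _) (*-congˡ (∑-pairWeight G ι inv)))))

        -- Applying `square-⊓⊔` to every pair bounds `2σ` times the energy by `(1 - ρ)` times
        -- `commonality` plus `2ρKW`. Since `1 - ρ` is nonnegative, `commonality≤` can be inserted;
        -- the right side adds up to `4ρKW`, that is `4σ²KW`, and `2σ` cancels.
        point-energy≤ : (1# + ρ) * (∑[ ω ∈ ωs ] q ω * energy G ι (point G (b ω) (m ω))) ≤ 2# * σ * (K * W G)
        point-energy≤ = *-cancelˡ-≤ (*-pos 0<2 0<σ) (begin
          2# * σ * ((1# + ρ) * η)
            ≈⟨ solve 3 (λ s t e → s :* (t :* e) := t :* (s :* e)) refl (2# * σ) (1# + ρ) η ⟩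
          (1# + ρ) * (2# * σ * η)
            ≤⟨ *-monoʳ-≤ 0≤1+ρ bound ⟩
          (1# + ρ) * ((1# - ρ) * E + 2# * ρ * (K * W G))
            ≈⟨ solve 3 (λ r e k → (con (+ 1) :+ r) :* ((con (+ 1) :- r) :* e :+ con (+ 2) :* r :* k)
                 := (con (+ 1) :- r) :* ((con (+ 1) :+ r) :* e) :+ (con (+ 1) :+ r) :* (con (+ 2) :* r :* k))
                 refl ρ E (K * W G) ⟩
          (1# - ρ) * ((1# + ρ) * E) + (1# + ρ) * (2# * ρ * (K * W G))
            ≤⟨ +-monoˡ-≤ _ (*-monoʳ-≤ (gap-nonneg ρ≤1) commonality≤) ⟩
          (1# - ρ) * (2# * ρ * (K * W G)) + (1# + ρ) * (2# * ρ * (K * W G))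
            ≈⟨ solve 2 (λ r k → (con (+ 1) :- r) :* (con (+ 2) :* r :* k) :+ (con (+ 1) :+ r) :* (con (+ 2) :* r :* k)
                 := con (+ 4) :* r :* k) refl ρ (K * W G) ⟩
          (1# + 1# + 1# + 1#) * ρ * (K * W G)
            ≈⟨ *-congʳ (*-congˡ σσ≈ρ) ⟨
          (1# + 1# + 1# + 1#) * (σ * σ) * (K * W G)
            ≈⟨ solve 2 (λ s k → con (+ 4) :* (s :* s) :* k := con (+ 2) :* s :* (con (+ 2) :* s :* k)) refl σ (K * W G) ⟩
          2# * σ * (2# * σ * (K * W G)) ∎)
          where
          E = commonality
          η = ∑[ ω ∈ ωs ] q ω * energy G ι (point G (b ω) (m ω))
          η-pairs : 2# * σ * η ≈ (∑[ i ∈ pairs G ι ] p i * (∑[ ω ∈ ωs ] q ω * (accord i ω *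
                      (2# * σ * (m ω (target (proj₁ i)) * m ω (target (proj₂ i)))))))
          η-pairs = trans (sym (∑-*ˡ ωs _ _)) (trans
            (∑-cong ωs λ ω → trans (*-congˡ (*-congˡ (energy-point G ι (b ω) (m ω))))
              (trans (sym (*-assoc _ _ _)) (sym (∑-*ˡ (pairs G ι) _ _))))
            (trans (∑-swap ωs (pairs G ι) _) (∑-cong (pairs G ι) λ i → trans
              (∑-cong ωs λ ω → solve 5 (λ s q p c x → s :* q :* (p :* (c :* x)) := p :* (q :* (c :* (s :* x)))) refl
                (2# * σ) (q ω) (p i) (accord i ω) (m ω (target (proj₁ i)) * m ω (target (proj₂ i))))
              (∑-*ˡ ωs _ _))))
          bound : 2# * σ * η ≤ (1# - ρ) * E + 2# * ρ * (K * W G)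
          bound = begin
            2# * σ * η
              ≈⟨ η-pairs ⟩
            _
              ≤⟨ ∑-mono-∈ (pairs G ι) (λ i i∈ → *-monoʳ-≤ (0≤p i) (pair-bound i i∈)) ⟩
            (∑[ i ∈ pairs G ι ] p i * ((1# - ρ) * shared i + 2# * ρ * K))
              ≈⟨ trans (∑-cong (pairs G ι) λ i → solve 4 (λ p t x k → p :* (t :* x :+ k) := t :* (p :* x) :+ k :* p) refl
                         (p i) (1# - ρ) (shared i) (2# * ρ * K))
                   (trans (∑-+ (pairs G ι) _ _) (+-cong (∑-*ˡ (pairs G ι) _ _)
                     (trans (∑-*ˡ (pairs G ι) _ _) (*-congˡ (∑-pairWeight G ι inv))))) ⟩
            (1# - ρ) * E + 2# * ρ * K * W G
              ≈⟨ +-congˡ (*-assoc _ _ _) ⟩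
            (1# - ρ) * E + 2# * ρ * (K * W G) ∎
            where
            pair-bound : ∀ i → i ∈ pairs G ι →
              (∑[ ω ∈ ωs ] q ω * (accord i ω * (2# * σ * (m ω (target (proj₁ i)) * m ω (target (proj₂ i))))))
                ≤ (1# - ρ) * shared i + 2# * ρ * K
            pair-bound i i∈ = begin
              _ ≤⟨ ∑-mono ωs (λ ω → *-monoʳ-≤ (0≤q ω) (≤-trans
                     (*-monoʳ-≤ (agree-nonneg G ι i _ _) (square-⊓⊔ σ _ _))
                     (≤-trans (≤-reflexive (distribˡ _ _ _)) (+-mono-≤ ≤-refl (≤-trans
                       (*-monoˡ-≤ (*-nonneg (square-nonneg σ) (larger-nonneg i ω)) (agree≤1 G ι projection i i∈ _ _))
                       (≤-reflexive (trans (*-identityˡ _) (*-congʳ σσ≈ρ)))))))) ⟩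
              (∑[ ω ∈ ωs ] q ω * (accord i ω * smaller i ω + ρ * larger i ω))
                ≈⟨ trans (∑-cong ωs λ ω → solve 4 (λ q x r l → q :* (x :+ r :* l) := q :* x :+ r :* (q :* l)) refl
                           (q ω) _ ρ (larger i ω))
                     (trans (∑-+ ωs _ _) (+-congˡ (∑-*ˡ ωs _ _))) ⟩
              -- Regrouped so that `spread i` occurs only in `spread i + shared i`, which is at most
              -- `2K`.
              shared i + ρ * spread i
                ≈⟨ solve 3 (λ x r y → x :+ r :* y := (con (+ 1) :- r) :* x :+ r :* (y :+ x)) refl (shared i) ρ (spread i) ⟩
              (1# - ρ) * shared i + ρ * (spread i + shared i)
                ≤⟨ +-mono-≤ ≤-refl (*-monoʳ-≤ 0≤ρ (spread+shared≤ i i∈)) ⟩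
              (1# - ρ) * shared i + ρ * (2# * K)
                ≈⟨ +-congˡ (solve 2 (λ r k → r :* (con (+ 2) :* k) := con (+ 2) :* r :* k) refl ρ K) ⟩
              (1# - ρ) * shared i + 2# * ρ * K ∎

    -- Concentrating each `h ω` does not lower its energy and keeps the totals, hence the norm
    -- bound, so the case of point masses suffices.
    energy≤ : (g₀ : Element (V G) → Element (Σ G)) → Element (Σ G) →
              (h : Element Ω → Assignment G) → (∀ ω v β → 0# ≤ h ω v β) →
              (∀ v → (∑[ ω ∈ ωs ] q ω * (total G (h ω) v * total G (h ω) v)) ≤ K) →
              (1# + ρ) * (∑[ ω ∈ ωs ] q ω * energy G ι (h ω)) ≤ 2# * σ * (K * W G)
    energy≤ g₀ β₀ h 0≤h norm≤ =
      ¬¬-choice Ω (λ ω → concentrate G ι 0≤ι (h ω) (0≤h ω) β₀) >>= λ { (b , E≤) →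
      ≤-trans (*-monoʳ-≤ 0≤1+ρ (∑-mono ωs λ ω → *-monoʳ-≤ (0≤q ω) (E≤ ω)))
        (point-energy≤ b (λ ω → total G (h ω)) norm≤ g₀) }

-- Tensor products and the induction on the number of copies.

module ParallelRepetition {c ℓ₁ ℓ₂} (ℝ : RealNumbers c ℓ₁ ℓ₂) where
  open RealNumbers ℝ
  open OrderedField ℝ
  open FiniteSums ℝ
  open Energy ℝ
  open Collision ℝ
  open VectorValue ℝ
  open IntegerCoefficients commutativeRing using (module Solver)
  open Solver
  open PosetReasoning ≤-poset
  open Games ℝ
  open Edge
  open Game

  module _ (G H : Game) where

    fiber-⊗ : ∀ u u′ e e′ → fiber (G ⊗ H) (u , u′) (e ⊗ᵉ e′) ≈ fiber G u e * fiber H u′ e′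
    fiber-⊗ u u′ e e′ = trans (*-congʳ (δ-× (U G) (U H) u u′ (source e) (source e′)))
      (solve 4 (λ a b c d → a :* b :* (c :* d) := a :* c :* (b :* d)) refl _ _ _ _)

    vertexWeight-⊗ : ∀ u u′ → vertexWeight (G ⊗ H) (u , u′) ≈ vertexWeight G u * vertexWeight H u′
    vertexWeight-⊗ u u′ = trans (∑-cartesianProductWith _⊗ᵉ_ (es G) (es H) _) (trans
      (∑-cong (es G) λ e → ∑-cong (es H) λ e′ → fiber-⊗ u u′ e e′)
      (sym (∑-* (es G) (es H) _ _)))

    infixr 7 _⊗ⁱ_
    _⊗ⁱ_ : (Element (U G) → Carrier) → (Element (U H) → Carrier) → Element (U (G ⊗ H)) → Carrier
    (ι ⊗ⁱ ι′) (u , u′) = ι u * ι′ u′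

    inverse-⊗ : ∀ {ι ι′} → (∀ u → GeneralisedInverse (vertexWeight G u) (ι u)) →
                (∀ u → GeneralisedInverse (vertexWeight H u) (ι′ u)) →
                ∀ u → GeneralisedInverse (vertexWeight (G ⊗ H) u) ((ι ⊗ⁱ ι′) u)
    inverse-⊗ inv inv′ (u , u′) = *-nonneg (proj₁ (inv u)) (proj₁ (inv′ u′)) , trans
      (*-congˡ (*-cong (vertexWeight-⊗ u u′) (vertexWeight-⊗ u u′))) (trans
      (solve 4 (λ i j w x → i :* j :* (w :* x :* (w :* x)) := i :* (w :* w) :* (j :* (x :* x))) refl _ _ _ _)
      (trans (*-cong (proj₂ (inv u)) (proj₂ (inv′ u′))) (sym (vertexWeight-⊗ u u′))))

    module _ (g : Element (V (G ⊗ H)) → Element (Σ (G ⊗ H))) where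

      g₁ : Element (V G) → Element (V H) → Element (Σ G)
      g₁ v v′ = proj₁ (g (v , v′))

      g₂ : Element (V G) → Element (V H) → Element (Σ H)
      g₂ v v′ = proj₂ (g (v , v′))

      -- The view of `g` from `G` once the first player's question and answer in `H` are fixed: the
      -- mass of `β` at `v` is the weight of the edges at `u′` that accept `α′` and on which `g`
      -- answers `β` in `G`.
      slice : Element (U H ×ᶠ Σ H) → Assignment G
      slice (u′ , α′) v β = ∑[ e′ ∈ es H ]
        fiber H u′ e′ * (δ (Σ G) β (g₁ v (target e′)) * 𝟙 (accepts e′ α′ (g₂ v (target e′))))

      slice-nonneg : ∀ ω v β → 0# ≤ slice ω v β
      slice-nonneg (u′ , α′) v β = ∑-nonneg (es H) λ e′ →
        *-nonneg (fiber-nonneg H u′ e′) (*-nonneg (δ-nonneg (Σ G) _ _) (𝟙-nonneg _))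

      slice-total : ∀ u′ α′ v → total G (slice (u′ , α′)) v ≈ hits H (g₂ v) u′ α′
      slice-total u′ α′ v = trans (∑-swap (as G) (es H) _) (∑-cong (es H) λ e′ → trans
        (∑-cong (as G) λ β → solve 3 (λ a b c → a :* (b :* c) := b :* (a :* c)) refl _ _ _)
        (∑-δ (Σ G) (λ _ → fiber H u′ e′ * 𝟙 (accepts e′ α′ (g₂ v (target e′)))) _))

      hits-⊗ : ∀ u u′ α α′ → hits (G ⊗ H) g (u , u′) (α , α′) ≈ amp G (slice (u′ , α′)) u α
      hits-⊗ u u′ α α′ = trans (∑-cartesianProductWith _⊗ᵉ_ (es G) (es H) _) (∑-cong (es G) λ e → sym (trans
        (*-congˡ (trans
          (∑-cong (as G) λ β → sym (∑-*ˡ (es H) (𝟙 (accepts e α β)) _))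
          (trans (∑-swap (as G) (es H) _) (∑-cong (es H) λ e′ → trans
            (∑-cong (as G) λ β → solve 4 (λ a f d b → a :* (f :* (d :* b)) := d :* (a :* (f :* b))) refl _ _ _ _)
            (∑-δ (Σ G) (λ β → 𝟙 (accepts e α β) * (fiber H u′ e′ * 𝟙 (accepts e′ α′ (g₂ (target e) (target e′))))) _)))))
        (trans (sym (∑-*ˡ (es H) _ _)) (∑-cong (es H) λ e′ → trans
          (solve 4 (λ f a f′ a′ → f :* (a :* (f′ :* a′)) := f :* f′ :* (a :* a′)) refl _ _ _ _)
          (sym (*-cong (fiber-⊗ u u′ e e′) (𝟙-∧ (accepts e α _) (accepts e′ α′ _))))))))

      collision-⊗ : ∀ ι ι′ → collision (G ⊗ H) (ι ⊗ⁱ ι′) g ≈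
        (∑[ ω ∈ elements (U H ×ᶠ Σ H) ] ι′ (proj₁ ω) * energy G ι (slice ω))
      collision-⊗ ι ι′ = trans (∑-× (U G) (U H) _) (trans
        (∑-cong (us G) λ u → ∑-cong (us H) λ u′ → trans (∑-× (Σ G) (Σ H) _) (trans
          (∑-swap (as G) (as H) _) (∑-cong (as H) λ α′ → ∑-cong (as G) λ α → trans
            (*-congˡ (*-cong (hits-⊗ u u′ α α′) (hits-⊗ u u′ α α′)))
            (solve 3 (λ i j x → i :* j :* x := j :* (i :* x)) refl (ι u) (ι′ u′) _))))
        (trans (∑-swap (us G) (us H) _) (trans
          (∑-cong (us H) λ u′ → trans (∑-swap (us G) (as H) _) (∑-cong (as H) λ α′ → trans
            (∑-cong (us G) λ u → ∑-*ˡ (as G) (ι′ u′) _) (∑-*ˡ (us G) (ι′ u′) _)))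
          (sym (∑-× (U H) (Σ H) _)))))

      -- For fixed `v`, summing out `β` leaves the hits of the strategy `g₂ v` of `H`. So a
      -- collision bound for `H` serves as the norm bound `K` for the slices.
      slice-norm : ∀ ι′ v →
        (∑[ ω ∈ elements (U H ×ᶠ Σ H) ] ι′ (proj₁ ω) * (total G (slice ω) v * total G (slice ω) v))
          ≈ collision H ι′ (g₂ v)
      slice-norm ι′ v = trans (∑-× (U H) (Σ H) _) (∑-cong (us H) λ u′ → ∑-cong (as H) λ α′ →
        *-congˡ (*-cong (slice-total u′ α′ v) (slice-total u′ α′ v)))

  vertex : (G : Game) → Element (V G)
  vertex G with edges G | total-pos G
  ... | []    | 0<0 = ⊥-elim (<-SPO.irrefl refl 0<0)
  ... | e ∷ _ | _   = target e

  √^-square : ∀ {x} → 0# ≤ x → ∀ k → x ^[ k /2] * x ^[ k /2] ≈ x ^ k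
  √^-square 0≤x zero    = *-identityˡ 1#
  √^-square {x} 0≤x (suc k) = trans
    (solve 2 (λ r p → r :* p :* (r :* p) := r :* r :* (p :* p)) refl (√ x) (x ^[ k /2]))
    (*-cong (√-square 0≤x) (√^-square 0≤x k))

  module _ (G : Game) (projection : IsProjection G)
           {ι : Element (U G) → Carrier} (inv : ∀ u → GeneralisedInverse (vertexWeight G u) (ι u))
           {ρ : Carrier} (0<ρ : 0# < ρ) (ρ≤1 : ρ ≤ 1#) (val≤ρ : val G ≤ ρ) (β₀ : Element (Σ G))
           where

    bound : Carrier
    bound = 2# * √ ρ / 1# + ρ [ 0<1+ 0<ρ ]

    0≤√ρ : 0# ≤ √ ρ
    0≤√ρ = √-nonneg (<⇒≤ 0<ρ)

    √ρ²≈ρ : √ ρ * √ ρ ≈ ρ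
    √ρ²≈ρ = √-square (<⇒≤ 0<ρ)

    √ρ≤1 : √ ρ ≤ 1#
    √ρ≤1 = square-cancel-≤ 0≤1 (≤-trans (≤-reflexive √ρ²≈ρ) (≤-trans ρ≤1 (≤-reflexive (sym (*-identityˡ 1#)))))

    bound-* : ∀ x → (1# + ρ) * (bound * x) ≈ 2# * √ ρ * x
    bound-* x = trans (solve 4 (λ d s r x → d :* (s :* r :* x) := s :* x :* (d :* r)) refl (1# + ρ) (2# * √ ρ) _ x)
      (trans (*-congˡ (*-recip _ (0<1+ 0<ρ))) (*-identityʳ _))

    0≤bound : 0# ≤ bound
    0≤bound = *-nonneg (*-nonneg (<⇒≤ 0<2) 0≤√ρ) (recip-nonneg _ (0<1+ 0<ρ))

    -- Serves the single-copy case, where the collision weight is at most `ρ` times the total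
    -- weight.
    ρ≤bound : ρ ≤ bound
    ρ≤bound = *-cancelˡ-≤ (0<1+ 0<ρ) (begin
      (1# + ρ) * ρ          ≤⟨ *-monoˡ-≤ (<⇒≤ 0<ρ) (+-mono-≤ ≤-refl ρ≤1) ⟩
      2# * ρ                ≈⟨ *-congˡ √ρ²≈ρ ⟨
      2# * (√ ρ * √ ρ)      ≤⟨ *-monoʳ-≤ (<⇒≤ 0<2) (*-monoʳ-≤ 0≤√ρ √ρ≤1) ⟩
      2# * (√ ρ * 1#)       ≈⟨ *-assoc _ _ _ ⟨
      2# * √ ρ * 1#         ≈⟨ bound-* 1# ⟨
      (1# + ρ) * (bound * 1#) ≈⟨ *-congˡ (*-identityʳ bound) ⟩
      (1# + ρ) * bound      ∎)

    inverseWeights : ∀ n → Element (U (G ^⊗ suc n)) → Carrier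
    inverseWeights zero    = ι
    inverseWeights (suc n) = _⊗ⁱ_ G (G ^⊗ suc n) ι (inverseWeights n)

    inverseWeights-inverse : ∀ n u → GeneralisedInverse (vertexWeight (G ^⊗ suc n) u) (inverseWeights n u)
    inverseWeights-inverse zero    = inv
    inverseWeights-inverse (suc n) = inverse-⊗ G (G ^⊗ suc n) inv (inverseWeights-inverse n)

    -- The exponent is not halved here: the collision weight controls the square of the winning
    -- probability. In the inductive step `energy≤` is applied to the slices, with the bound for the
    -- remaining copies as `K`.
    collision-^ : ∀ n g → collision (G ^⊗ suc n) (inverseWeights n) g ≤ bound ^ suc n * W (G ^⊗ suc n)
    collision-^ zero    g = ≤-trans (collision≤val G inv projection val≤ρ β₀ g)
      (*-monoˡ-≤ (<⇒≤ (total-pos G)) (≤-trans ρ≤bound (≤-reflexive (sym (*-identityʳ bound)))))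
    collision-^ (suc n) g = ≤-or-> (√ ρ) 0# >>= λ
      -- A vanishing root would make its square `ρ` vanish.
      { (inj₁ √ρ≤0) → λ _ → <-SPO.irrefl (trans (sym (trans (*-congˡ (≤-antisym √ρ≤0 0≤√ρ)) (zeroʳ _))) √ρ²≈ρ) 0<ρ
      ; (inj₂ 0<√ρ) → *-cancelˡ-≤ (0<1+ 0<ρ) (begin
          (1# + ρ) * collision (G ⊗ H) (_⊗ⁱ_ G H ι ι′) g
            ≈⟨ *-congˡ (collision-⊗ G H g ι ι′) ⟩
          (1# + ρ) * (∑[ ω ∈ elements (U H ×ᶠ Σ H) ] ι′ (proj₁ ω) * energy G ι (slice G H g ω))
            ≤⟨ energy≤ G projection inv 0<√ρ √ρ²≈ρ 0<ρ ρ≤1 (collision≤val G inv projection val≤ρ β₀)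
                 (U H ×ᶠ Σ H) (λ ω → proj₁ (inverseWeights-inverse n (proj₁ ω)))
                 (*-nonneg (^-nonneg 0≤bound (suc n)) (<⇒≤ (total-pos H)))
                 (λ _ → β₀) β₀ (slice G H g) (slice-nonneg G H g)
                 (λ v → ≤-trans (≤-reflexive (slice-norm G H g ι′ v)) (collision-^ n (g₂ G H g v))) ⟩
          2# * √ ρ * (bound ^ suc n * W H * W G)
            ≈⟨ bound-* _ ⟨
          (1# + ρ) * (bound * (bound ^ suc n * W H * W G))
            ≈⟨ *-congˡ (solve 4 (λ b p h w → b :* (p :* h :* w) := b :* p :* (w :* h)) refl bound (bound ^ suc n) (W H) (W G)) ⟩
          (1# + ρ) * (bound ^ suc (suc n) * (W G * W H))
            ≈⟨ *-congˡ (*-congˡ (totalWeight-⊗ (edges G) (edges H))) ⟨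
          (1# + ρ) * (bound ^ suc (suc n) * W (G ⊗ H)) ∎) }
      where
      H = G ^⊗ suc n
      ι′ = inverseWeights n

    win-^ : ∀ n f g → win (G ^⊗ suc n) f g ≤ bound ^[ suc n /2] * W (G ^⊗ suc n)
    win-^ n f g = square-cancel-≤ (*-nonneg (^-nonneg (√-nonneg 0≤bound) (suc n)) 0≤W) (begin
      win Gⁿ f g * win Gⁿ f g
        ≤⟨ win²≤collision Gⁿ (inverseWeights-inverse n) f g ⟩
      W Gⁿ * collision Gⁿ (inverseWeights n) g
        ≤⟨ *-monoʳ-≤ 0≤W (collision-^ n g) ⟩
      W Gⁿ * (bound ^ suc n * W Gⁿ)
        ≈⟨ *-congˡ (*-congʳ (√^-square 0≤bound (suc n))) ⟨
      W Gⁿ * (r * r * W Gⁿ)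
        ≈⟨ solve 2 (λ w r → w :* (r :* r :* w) := r :* w :* (r :* w)) refl (W Gⁿ) r ⟩
      r * W Gⁿ * (r * W Gⁿ) ∎)
      where
      Gⁿ = G ^⊗ suc n
      r = bound ^[ suc n /2]
      0≤W : 0# ≤ W Gⁿ
      0≤W = <⇒≤ (total-pos Gⁿ)

  firstAnswer : ∀ G n → Element (Σ (G ^⊗ suc n)) → Element (Σ G)
  firstAnswer G zero    = λ α → α
  firstAnswer G (suc n) = proj₁

theorem1p1 :
    ∀ {c ℓ₁ ℓ₂ : Level} (ℝ : RealNumbers c ℓ₁ ℓ₂) →
    let open RealNumbers ℝ
        open Games ℝ
    in
    (G : Game) → IsProjection G →
    (ρ : Carrier) (0<ρ : 0# < ρ) → ρ ≤ 1# →
    val G ≤ ρ →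
    (k : ℕ) .{{_ : NonZero k}} →
    val (G ^⊗ k) ≤ ((2# * √ ρ) / (1# + ρ) [ 0<1+ 0<ρ ]) ^[ k /2]
theorem1p1 ℝ G projection ρ 0<ρ ρ≤1 val≤ρ (suc n) =
  ¬¬-choice (U G) (λ u → generalisedInverse (vertexWeight G u) (vertexWeight-nonneg G u)) >>= λ { (ι , inv) →
    val-least (G ^⊗ suc n)
      (^-nonneg (√-nonneg (*-nonneg (*-nonneg (<⇒≤ 0<2) (√-nonneg (<⇒≤ 0<ρ))) (recip-nonneg _ (0<1+ 0<ρ)))) (suc n))
      -- The alphabet might be empty, but a strategy `g` evaluated at some vertex provides the
      -- answer of `G` needed as a default; the vertex exists because the total weight is positive.
      λ f g → win-^ G projection inv 0<ρ ρ≤1 val≤ρ (firstAnswer G n (g (vertex (G ^⊗ suc n)))) n f g }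
  where
  open RealNumbers ℝ
  open OrderedField ℝ
  open Collision ℝ
  open ParallelRepetition ℝ
  open Games ℝ
  open Game
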